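{- Let $n\ge 1$ and $0\le e\le\binom{n}{2}$. For every simple graph $G$ with $n$ vertices and $e$ edges, and for every integer $k\ge 0$, $$m(G) \geq \min\{ m(\mathcal{L}(n,e)), m(\mathcal{C}(n,e))\}$$ and $$m_k(G) \geq \min\{ m_k(\mathcal{L}(n,e)), m_k(\mathcal{C}(n,e))\}.$$
   Context: A matching in a graph is a set of pairwise non-incident edges (the empty set is a matching). $m(G)$ denotes the number of matchings of $G$ and $m_k(G)$ the number of matchings of $G$ with exactly $k$ edges. The lexicographic order on finite subsets of $\mathbb{N}$ is $A<_L B$ iff $\min(A\Delta B)\in A$; the colexicographic order is $A<_C B$ iff $\max(A\Delta B)\in B$. Restricting these to $2$-subsets of $[n]=\{1,\dots,n\}$ orders the edges of $K_n$. The lex graph $\mathcal{L}(n,e)$ has vertex set $[n]$ and edge set the first $e$ edges of $K_n$ in lex order (i.e. $\{1,2\},\{1,3\},\dots,\{1,n\},\{2,3\},\dots$); the colex graph $\mathcal{C}(n,e)$ has vertex set $[n]$ and edge set the first $e$ edges of $K_n$ in colex order (i.e. $\{1,2\},\{1,3\},\{2,3\},\{1,4\},\{2,4\},\{3,4\},\{1,5\},\dots$). -}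

module Defs where

open import Data.Bool using (Bool; true; false; _∧_; _∨_; not)
open import Data.Nat using (ℕ; zero; suc; _≡ᵇ_; _<ᵇ_)
open import Data.Fin using (Fin; toℕ)
open import Data.Product using (_×_; _,_; proj₁; proj₂)
open import Data.List using (List; []; _∷_; _++_; map; concatMap; allFin; filterᵇ; length; take)
open import Data.Bool.ListAction using (any; all)

-- An edge is an ordered pair (i , j) of vertices of [n] = Fin n, always with i < j.
Edge : ℕ → Set
Edge n = Fin n × Fin n

lexPairs : (n : ℕ) → List (Edge n)
lexPairs n = concatMap (λ i → concatMap (λ j → if< i j) (allFin n)) (allFin n)
  where
  if< : Fin n → Fin n → List (Edge n)
  if< i j with toℕ i <ᵇ toℕ j
  ... | true  = (i , j) ∷ []
  ... | false = []

colexPairs : (n : ℕ) → List (Edge n)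
colexPairs n = concatMap (λ j → concatMap (λ i → if< i j) (allFin n)) (allFin n)
  where
  if< : Fin n → Fin n → List (Edge n)
  if< i j with toℕ i <ᵇ toℕ j
  ... | true  = (i , j) ∷ []
  ... | false = []

-- A simple graph on vertex set [n]: the edge {i,j} (i<j) is present iff  adj i j ≡ true.
-- Only the values on pairs i < j are consulted, so every simple graph on [n] is
-- represented (possibly by several functions, all giving the same edge set).
Graph : ℕ → Set
Graph n = Fin n → Fin n → Bool

edges : {n : ℕ} → Graph n → List (Edge n)
edges {n} G = filterᵇ (λ p → G (proj₁ p) (proj₂ p)) (lexPairs n)

numEdges : {n : ℕ} → Graph n → ℕ
numEdges G = length (edges G)

_≡ꟳ_ : {n : ℕ} → Fin n → Fin n → Bool
a ≡ꟳ b = toℕ a ≡ᵇ toℕ b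

elemᵉ : {n : ℕ} → Edge n → List (Edge n) → Bool
elemᵉ (i , j) = any (λ p → (proj₁ p ≡ꟳ i) ∧ (proj₂ p ≡ꟳ j))

fromPairs : {n : ℕ} → List (Edge n) → Graph n
fromPairs ps i j = elemᵉ (i , j) ps

lexGraph : (n e : ℕ) → Graph n
lexGraph n e = fromPairs (take e (lexPairs n))

colexGraph : (n e : ℕ) → Graph n
colexGraph n e = fromPairs (take e (colexPairs n))

-- all sublists (= subsets, as the list has no repetitions) of a list
sublists : {A : Set} → List A → List (List A)
sublists []       = [] ∷ []
sublists (x ∷ xs) = sublists xs ++ map (x ∷_) (sublists xs)

disjointᵉ : {n : ℕ} → Edge n → Edge n → Bool
disjointᵉ (a , b) (c , d) =
  not ((a ≡ꟳ c) ∨ (a ≡ꟳ d) ∨ (b ≡ꟳ c) ∨ (b ≡ꟳ d))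

isMatching : {n : ℕ} → List (Edge n) → Bool
isMatching []       = true
isMatching (x ∷ xs) = all (disjointᵉ x) xs ∧ isMatching xs

matchings : {n : ℕ} → Graph n → List (List (Edge n))
matchings G = filterᵇ isMatching (sublists (edges G))

-- m(G): number of matchings (including the empty one)
m : {n : ℕ} → Graph n → ℕ
m G = length (matchings G)

mₖ : {n : ℕ} → ℕ → Graph n → ℕ
mₖ k G = length (filterᵇ (λ M → length M ≡ᵇ k) (matchings G))

{-# OPTIONS --safe #-}
module Submission where

-- Every graph G on n vertices with e edges satisfies m_k(G) ≥ m_k(H) for all k at once, where H is one
-- of L(n,e), C(n,e); so the bound on the total number of matchings follows by summation.
--
-- Moving the private neighbours of x to w does not increase any m_k (a rearrangement inequality).
-- Doing this for a fixed w until deg w is maximal makes w dominating or leaves an isolated vertex, and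
-- induction on n applies to the rest. It remains to compare L(n,e) plus an isolated vertex with
-- L(n+1,e), and C(n,e) plus a dominating vertex with C(n+1,n+e). Adding an isolated vertex to
-- L(n,e) = (K_a join a quasi-star on q vertices) can be improved to L(n+1,e) when q > a; when q ≤ a + 1
-- the comparison is reversed and stays reversed for smaller n, so the chain L(n,e), L(n-1,e), … descends
-- to C(n,e). Dually, for C(n,e) with clique size t the comparison depends on n versus 2t + 1, and
-- in the reversed case C(n+1,n+e) dominates C(n,e) plus a dominating vertex, which descends to lex.

-- A bound for each k separately would not survive the induction: by `D`, the k-matchings after
-- adding a dominating vertex involve the (k-1)-matchings before it, so one extremal graph has to
-- serve all k. This is why profiles are compared as functions, by `⊵`, and why `Extremal` fixes lex
-- or colex before k.
--
-- For fixed n and k, the numbers of (k+1)-matchings of L(n,e) and C(n,e) are piecewise linear in e: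
-- each new edge contributes the k-matchings that avoid both its endpoints, and this number is
-- constant while one star, or one further clique vertex, is being filled. The slopes never
-- decrease, so both functions are convex and lie above their tangents at the corners. Several
-- comparisons below therefore have a quasi-star or quasi-clique, known exactly, on one side and a
-- tangent at a nearby corner on the other; what is left is to compare slopes. For lex this asks
-- whether two independent vertices may be traded for one dominating vertex, going from K_a join q +
-- 2 vertices to K_(a+1) join q vertices. The answer flips as q passes a, which is where the
-- threshold between q and a comes from.

open import Defs
open import Data.Bool using (Bool; true; false; not; _∨_; _∧_; if_then_else_)
open import Data.Bool.ListAction using (any; all)
open import Data.Bool.Properties using (∧-zeroʳ; ∧-identityʳ; ∨-identityʳ; ∨-assoc; ∨-comm; ¬-not; T-≡)
open import Data.Fin as Fin using (Fin; toℕ)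
open import Data.Fin.Properties using (toℕ-injective; toℕ<n)
open import Data.List using (List; []; _∷_; _++_; map; concat; concatMap; allFin; tabulate; upTo; applyUpTo; downFrom; filterᵇ; length; take)
open import Data.List.Properties
open import Data.List.Relation.Binary.Permutation.Propositional using (_↭_; refl; prep; swap; ↭-refl; ↭-sym; ↭-reflexive; ↭-trans; ↭-prep; ↭-swap) renaming (trans to transᵖ)
open import Data.List.Relation.Binary.Permutation.Propositional.Properties using (All-resp-↭; ↭-length; ↭-reverse)
open import Data.List.Relation.Unary.All as All using (All; []; _∷_)
import Data.List.Relation.Unary.All.Properties as Allₚ
open import Data.List.Relation.Unary.AllPairs as AllPairs using (AllPairs; []; _∷_)
import Data.List.Relation.Unary.AllPairs.Properties as AllPairsₚ
open import Data.List.Relation.Unary.Unique.Propositional using (Unique)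
open import Data.Nat
open import Data.Nat.Combinatorics using (_C_)
open import Data.Nat.Properties hiding (_≟_)
open import Data.Nat.Tactic.RingSolver using (solve-∀)
open import Data.Product using (_×_; _,_; ∃₂; Σ-syntax; proj₁; proj₂)
open import Data.Sum using (_⊎_; inj₁; inj₂)
open import Function using (_∘_; id; Equivalence)
open import Relation.Binary.Definitions using (DecidableEquality)
open import Relation.Binary.PropositionalEquality using (_≡_; _≢_; _≗_; refl; trans; cong; cong₂; sym; subst; module ≡-Reasoning)
open import Relation.Nullary using (¬_; yes; no; contradiction)

-- Matching numbers of a clique joined to independent vertices

-- W a q k is the number of k-matchings of the join of K_a with q isolated vertices;
-- the factor a annihilates the junk value at pred 0.
W : ℕ → ℕ → ℕ → ℕ
W a       q       zero    = 1
W a       (suc q) (suc k) = W a q (suc k) + a * W (pred a) q k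
W zero    zero    (suc k) = 0
W (suc a) zero    (suc k) = W a 0 (suc k) + a * W (pred a) 0 k

W-zero : ∀ q k → W 0 q (suc k) ≡ 0
W-zero zero    k = refl
W-zero (suc q) k = trans (+-identityʳ _) (W-zero q k)

-- Two counts of k-matchings with a marked edge between the clique and the independent set: q (W a q
-- - W a (q-1)) marks it at its independent end, a (W a q - W (a-1) (q+1)) at its clique end. The
-- equation is the additive form. It is proved together with `W-dominator`, and k drops by one on
-- the way round.
W-exchange : ∀ k a q →
  q * W a (pred q) k + a * W a q k ≡ a * W (pred a) (suc q) k + q * W a q k

-- Promoting one independent vertex to a dominating one adds its edges to the q other independent
-- vertices; the last term counts the matchings that use one of these.
W-dominator : ∀ k a q →
  W (suc a) q (suc k) ≡ W a (suc q) (suc k) + q * W a (pred q) k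

W-dominator k a zero    = sym (+-identityʳ _)
W-dominator k a (suc q) = begin
  W (suc a) q (suc k) + suc a * W a q k
    ≡⟨ cong (_+ suc a * W a q k) (W-dominator k a q) ⟩
  W a (suc q) (suc k) + q * W a (pred q) k + suc a * W a q k
    ≡⟨ rearrange (W a (suc q) (suc k)) (q * W a (pred q) k) (a * W (pred a) (suc q) k)
         a q (W a q k) (W-exchange k a q) ⟩
  W a (suc q) (suc k) + a * W (pred a) (suc q) k + suc q * W a q k ∎
  where
  open ≡-Reasoning
  rearrange : ∀ z u v a q g → u + a * g ≡ v + q * g →
              z + u + suc a * g ≡ z + v + suc q * g
  rearrange z u v a q g eq = trans (l₁ z u a g) (trans (cong (λ s → z + g + s) eq) (l₂ z v q g))
    where
    l₁ : ∀ z u a g → z + u + suc a * g ≡ z + g + (u + a * g)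
    l₁ = solve-∀
    l₂ : ∀ z v q g → z + g + (v + q * g) ≡ z + v + suc q * g
    l₂ = solve-∀

W-exchange zero    a q = l a q
  where
  l : ∀ a q → q * 1 + a * 1 ≡ a * 1 + q * 1
  l = solve-∀
W-exchange (suc k) zero zero = refl
W-exchange (suc k) zero (suc q)
  rewrite W-zero q k = +-identityʳ _
W-exchange (suc k) (suc a) zero =
  trans (cong (suc a *_) (trans (W-dominator k a 0) (+-identityʳ _))) (sym (+-identityʳ _))
W-exchange (suc k) (suc a) (suc q)
  rewrite W-dominator k a q =
  rearrange (W a (suc q) (suc k)) (q * W a (pred q) k) (a * W (pred a) (suc q) k)
    a q (W a q k) (W-exchange k a q)
  where
  rearrange : ∀ z u v a q g → u + a * g ≡ v + q * g →
    suc q * (z + u) + suc a * (z + u + suc a * g) ≡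
    suc a * (z + v) + suc q * (z + u + suc a * g)
  rearrange z u v a q g eq =
    trans (l₁ z u a q g) (trans (cong (λ s → suc q * (z + u) + suc a * (z + g + s)) eq) (l₂ z u v a q g))
    where
    l₁ : ∀ z u a q g → suc q * (z + u) + suc a * (z + u + suc a * g) ≡
                       suc q * (z + u) + suc a * (z + g + (u + a * g))
    l₁ = solve-∀
    l₂ : ∀ z u v a q g → suc q * (z + u) + suc a * (z + g + (v + q * g)) ≡
                       suc a * (z + v) + suc q * (z + u + suc a * g)
    l₂ = solve-∀

-- Double counting of pairs (k-matching, uncovered vertex), with the 2k covered vertices moved to the left.
W-delete : ∀ k a q →
  a * W (pred a) q k + q * W a (pred q) k + 2 * k * W a q k ≡ (a + q) * W a q k
W-delete zero    a q = l a q
  where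
  l : ∀ a q → a * 1 + q * 1 + 0 ≡ (a + q) * 1
  l = solve-∀
W-delete (suc k) zero q
  rewrite W-zero (pred q) k | W-zero q k | *-zeroʳ q | *-zeroʳ (2 * suc k) = refl
W-delete (suc k) (suc zero) zero rewrite *-zeroʳ (2 * suc k) = refl
W-delete (suc k) (suc (suc a)) zero =
  rearrange a k (W a 0 (suc k)) (W (pred a) 0 k) (W (suc a) 0 (suc k)) (W a 0 k) refl
    (W-delete (suc k) (suc a) 0) (W-delete k a 0)
  where
  rearrange : ∀ a k x y z w → x + a * y ≡ z →
    suc a * x + 0 + 2 * suc k * z ≡ (suc a + 0) * z →
    a * y + 0 + 2 * k * w ≡ (a + 0) * w →
    suc (suc a) * z + 0 + 2 * suc k * (z + suc a * w) ≡
    (suc (suc a) + 0) * (z + suc a * w)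
  rearrange a k x y z w refl e₁ e₂ =
    trans (l₁ a k x y w) (trans (cong₂ (λ s t → x + a * y + s + suc a * (t + 2 * w)) e₁ e₂) (l₂ a x y w))
    where
    l₁ : ∀ a k x y w →
      suc (suc a) * (x + a * y) + 0 + 2 * suc k * (x + a * y + suc a * w) ≡
      x + a * y + (suc a * x + 0 + 2 * suc k * (x + a * y))
        + suc a * (a * y + 0 + 2 * k * w + 2 * w)
    l₁ = solve-∀
    l₂ : ∀ a x y w →
      x + a * y + (suc a + 0) * (x + a * y) + suc a * ((a + 0) * w + 2 * w) ≡
      (suc (suc a) + 0) * (x + a * y + suc a * w)
    l₂ = solve-∀
W-delete (suc k) (suc a) (suc q) =
  rearrange a q k (W a q (suc k)) (W (pred a) q k) (W (suc a) q (suc k)) (W a q k)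
    (W (suc a) (pred q) (suc k)) (W a (pred q) k) (step q) (W-delete (suc k) (suc a) q) (W-delete k a q)
  where
  step : ∀ q → q * W (suc a) q (suc k) ≡
         q * W (suc a) (pred q) (suc k) + q * (suc a * W a (pred q) k)
  step zero    = refl
  step (suc q) = *-distribˡ-+ (suc q) (W (suc a) q (suc k)) _
  rearrange : ∀ a q k x y z w u v → q * z ≡ q * u + q * (suc a * v) →
    suc a * x + q * u + 2 * suc k * z ≡ (suc a + q) * z →
    a * y + q * v + 2 * k * w ≡ (a + q) * w →
    suc a * (x + a * y) + suc q * z + 2 * suc k * (z + suc a * w) ≡
    (suc a + suc q) * (z + suc a * w)
  rearrange a q k x y z w u v e₀ e₁ e₂ =
    trans (l₁ a q k x y z w) (trans (cong (λ s → suc a * x + suc a * (a * y) + (z + s) + 2 * suc k * (z + suc a * w)) e₀)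
    (trans (l₃ a q k x y z w u v) (trans (cong₂ (λ s t → z + s + suc a * (t + 2 * w)) e₁ e₂) (l₂ a q z w))))
    where
    l₁ : ∀ a q k x y z w →
      suc a * (x + a * y) + suc q * z + 2 * suc k * (z + suc a * w) ≡
      suc a * x + suc a * (a * y) + (z + q * z) + 2 * suc k * (z + suc a * w)
    l₁ = solve-∀
    l₃ : ∀ a q k x y z w u v →
      suc a * x + suc a * (a * y) + (z + (q * u + q * (suc a * v))) + 2 * suc k * (z + suc a * w) ≡
      z + (suc a * x + q * u + 2 * suc k * z) + suc a * (a * y + q * v + 2 * k * w + 2 * w)
    l₃ = solve-∀
    l₂ : ∀ a q z w →
      z + (suc a + q) * z + suc a * ((a + q) * w + 2 * w) ≡ (suc a + suc q) * (z + suc a * w)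
    l₂ = solve-∀

-- `W-delete` in the subtractive form in which `D` counts, with j further isolated vertices, which
-- no matching covers.
W-uncovered : ∀ a q j k →
  (a + q + j ∸ 2 * k) * W a q k ≡ a * W (pred a) q k + q * W a (pred q) k + j * W a q k
W-uncovered a q j k = begin
  (a + q + j ∸ 2 * k) * w                       ≡⟨ *-distribʳ-∸ w (a + q + j) (2 * k) ⟩
  (a + q + j) * w ∸ 2 * k * w                   ≡⟨ cong (_∸ 2 * k * w) (*-distribʳ-+ w (a + q) j) ⟩
  (a + q) * w + j * w ∸ 2 * k * w               ≡⟨ cong (λ s → s + j * w ∸ 2 * k * w) (sym (W-delete k a q)) ⟩
  d + 2 * k * w + j * w ∸ 2 * k * w             ≡⟨ cong (_∸ 2 * k * w) (l d (2 * k * w) (j * w)) ⟩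
  d + j * w + 2 * k * w ∸ 2 * k * w             ≡⟨ m+n∸n≡m (d + j * w) (2 * k * w) ⟩
  d + j * w ∎
  where
  open ≡-Reasoning
  w d : ℕ
  w = W a q k
  d = a * W (pred a) q k + q * W a (pred q) k
  l : ∀ x y z → x + y + z ≡ x + z + y
  l = solve-∀

W-mono-independent : ∀ a q k → W a q k ≤ W a (suc q) k
W-mono-independent a q zero    = ≤-refl
W-mono-independent a q (suc k) = m≤m+n _ _

-- These are consecutive slopes of lex as a function of e, and for q = 0 of colex, so this
-- inequality is the convexity of both.
W-mono-dominator : ∀ a q k → W a q k ≤ W (suc a) (pred q) k
W-mono-dominator a q       zero    = ≤-refl
W-mono-dominator a zero    (suc k) = m≤m+n _ _
W-mono-dominator a (suc q) (suc k) =
  ≤-trans (m≤m+n _ _) (≤-reflexive (sym (W-dominator k a q)))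

-- Both sides exceed `W a (suc q)`: the left by a copies of the same left side with a and q lowered
-- by one, the right by q copies of the corresponding right side. So the coefficients a and q
-- decide.
W-dominator≥ : ∀ k a q → a ≤ q → W a (suc (suc q)) k ≤ W (suc a) q k
W-dominator≥ zero    a q _ = ≤-refl
W-dominator≥ (suc k) a q a≤q rewrite W-dominator k a q = +-monoʳ-≤ (W a (suc q) (suc k)) (lem a q a≤q)
  where
  lem : ∀ a q → a ≤ q → a * W (pred a) (suc q) k ≤ q * W a (pred q) k
  lem zero    q       _         = z≤n
  lem (suc a) (suc q) (s≤s a≤q) = *-mono-≤ (s≤s a≤q) (W-dominator≥ k a q a≤q)

W-dominator≤ : ∀ k a q → q ≤ a → W (suc a) q k ≤ W a (suc (suc q)) k
W-dominator≤ zero    a q _ = ≤-refl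
W-dominator≤ (suc k) a q q≤a rewrite W-dominator k a q = +-monoʳ-≤ (W a (suc q) (suc k)) (lem a q q≤a)
  where
  lem : ∀ a q → q ≤ a → q * W a (pred q) k ≤ a * W (pred a) (suc q) k
  lem a       zero    _         = z≤n
  lem (suc a) (suc q) (s≤s q≤a) = *-mono-≤ (s≤s q≤a) (W-dominator≤ k a q q≤a)

-- Comparison of matching profiles, and the effect of a dominating vertex

tri : ℕ → ℕ
tri zero    = 0
tri (suc n) = n + tri n

tri-mono : ∀ {m n} → m ≤ n → tri m ≤ tri n
tri-mono z≤n       = z≤n
tri-mono (s≤s m≤n) = +-mono-≤ m≤n (tri-mono m≤n)

W-edges : ∀ t → W t 0 1 ≡ tri t
W-edges zero    = refl
W-edges (suc t) = trans (cong₂ _+_ (W-edges t) (*-identityʳ t)) (+-comm (tri t) t)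

infix 4 _⊵_
_⊵_ : (p p′ : ℕ → ℕ) → Set
p ⊵ p′ = ∀ k → p′ k ≤ p k

⊵-trans : ∀ {p p′ p″} → p ⊵ p′ → p′ ⊵ p″ → p ⊵ p″
⊵-trans f g k = ≤-trans (g k) (f k)

≗⇒⊵ : ∀ {p p′ : ℕ → ℕ} → p ≗ p′ → p ⊵ p′
≗⇒⊵ f k = ≤-reflexive (sym (f k))

-- The effect of a new dominating vertex on the matching numbers p of a graph with n vertices:
-- it can be matched to any of the n − 2k vertices left uncovered by a k-matching.
D : ℕ → (ℕ → ℕ) → ℕ → ℕ
D n p zero    = p 0
D n p (suc k) = p (suc k) + (n ∸ 2 * k) * p k

D-mono : ∀ n {p p′} → p ⊵ p′ → D n p ⊵ D n p′
D-mono n f zero    = f 0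
D-mono n f (suc k) = +-mono-≤ (f (suc k)) (*-monoʳ-≤ (n ∸ 2 * k) (f k))

D-cong : ∀ n {p p′} → p ≗ p′ → D n p ≗ D n p′
D-cong n f zero    = f 0
D-cong n f (suc k) = cong₂ (λ x y → x + (n ∸ 2 * k) * y) (f (suc k)) (f k)

-- Lex graphs: quasi-stars, convexity and isolated vertices

star : ℕ → ℕ → ℕ
star e zero          = 1
star e (suc zero)    = e
star e (suc (suc k)) = 0

-- lex n e k is the number of k-matchings of L(n,e).
lex : ℕ → ℕ → ℕ → ℕ
lex zero    e = star 0
lex (suc n) e with e ≤? n
... | yes _ = star e
... | no  _ = D n (lex n (e ∸ n))

lex-star : ∀ {n e} → e ≤ n → lex (suc n) e ≡ star e
lex-star {n} {e} e≤n with e ≤? n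
... | yes _   = refl
... | no  e≰n = contradiction e≤n e≰n

lex-empty : ∀ n → lex n 0 ≡ star 0
lex-empty zero    = refl
lex-empty (suc n) = lex-star {n} z≤n

D-star-zero : ∀ n → star n ≗ D n (star 0)
D-star-zero n zero                = refl
D-star-zero n (suc zero)          = sym (*-identityʳ n)
D-star-zero n (suc (suc zero))    = sym (*-zeroʳ (n ∸ 2))
D-star-zero n (suc (suc (suc k))) = sym (*-zeroʳ (n ∸ 2 * suc (suc k)))

-- Only e = 0 falls under the star clause of `lex`; there a full star is a dominating vertex over an
-- edgeless graph, which is `D-star-zero`.
lex-dominator : ∀ n e → lex (suc n) (n + e) ≗ D n (lex n e)
lex-dominator n e k with n + e ≤? n
lex-dominator n zero    k | yes p rewrite +-identityʳ n | lex-empty n = D-star-zero n k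
lex-dominator n (suc e) k | yes p = contradiction p (m+1+n≰m n)
lex-dominator n e       k | no _ rewrite m+n∸m≡n n e = refl

lex-zero : ∀ n e → lex n e 0 ≡ 1
lex-zero zero    e = refl
lex-zero (suc n) e with e ≤? n
... | yes _ = refl
... | no  _ = lex-zero n (e ∸ n)

-- E a q is the number of edges of the join of K_a with q isolated vertices.
E : ℕ → ℕ → ℕ
E zero    q = 0
E (suc a) q = a + q + E a q

E-suc : ∀ a q → E a (suc q) ≡ a + E a q
E-suc zero    q = refl
E-suc (suc a) q rewrite E-suc a q = l a q (E a q)
  where
  l : ∀ a q x → a + suc q + (a + x) ≡ suc a + (a + q + x)
  l = solve-∀

E-last : ∀ a q → E (suc a) q ≡ E a (suc q) + q
E-last a q rewrite E-suc a q = l a q (E a q)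
  where
  l : ∀ a q x → a + q + x ≡ a + x + q
  l = solve-∀

D-W : ∀ a q → D (a + q) (W a q) ≗ W (suc a) q
D-W a q zero    = refl
D-W a q (suc k) = begin
  W a q (suc k) + (a + q ∸ 2 * k) * W a q k
    ≡⟨ cong (λ n → W a q (suc k) + (n ∸ 2 * k) * W a q k) (sym (+-identityʳ (a + q))) ⟩
  W a q (suc k) + (a + q + 0 ∸ 2 * k) * W a q k
    ≡⟨ cong (W a q (suc k) +_) (trans (W-uncovered a q 0 k) (+-identityʳ _)) ⟩
  W a q (suc k) + (a * W (pred a) q k + q * W a (pred q) k)
    ≡⟨ sym (+-assoc (W a q (suc k)) _ _) ⟩
  W a (suc q) (suc k) + q * W a (pred q) k
    ≡⟨ sym (W-dominator k a q) ⟩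
  W (suc a) q (suc k) ∎
  where open ≡-Reasoning

-- a dominating vertices, then a star with r edges on the other q vertices
quasiStar : ℕ → ℕ → ℕ → ℕ → ℕ
quasiStar a q r zero    = 1
quasiStar a q r (suc k) = W a q (suc k) + r * W a (pred (pred q)) k

quasiStar-dominator : ∀ a q r → r ≤ pred q →
  D (a + q) (quasiStar a q r) ≗ quasiStar (suc a) q r
quasiStar-dominator a q r _ zero = refl
quasiStar-dominator a q r _ (suc zero) =
  trans (l (W a q 1) r (a + q)) (cong (_+ r * 1) (D-W a q 1))
  where
  l : ∀ x r n → x + r * 1 + n * 1 ≡ x + n * 1 + r * 1
  l = solve-∀
quasiStar-dominator a q zero r≤ (suc (suc k)) =
  trans (l (W a q (suc (suc k))) (a + q ∸ 2 * suc k) (W a q (suc k)))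
        (cong (_+ 0) (D-W a q (suc (suc k))))
  where
  l : ∀ x n y → x + 0 + n * (y + 0) ≡ x + n * y + 0
  l = solve-∀
quasiStar-dominator a (suc (suc q)) r r≤ (suc (suc k)) =
  trans (l (W a (suc (suc q)) (suc (suc k))) r (W a q (suc k)) (a + suc (suc q) ∸ 2 * suc k)
           (W a (suc (suc q)) (suc k)) (W a q k))
        (cong₂ (λ x y → x + r * y) (D-W a (suc (suc q)) (suc (suc k)))
          (trans (cong (λ n → W a q (suc k) + n * W a q k) shift) (D-W a q (suc k))))
  where
  l : ∀ x r y n z w → x + r * y + n * (z + r * w) ≡ x + n * z + r * (y + n * w)
  l = solve-∀
  shift : a + suc (suc q) ∸ 2 * suc k ≡ a + q ∸ 2 * k
  shift = cong₂ _∸_ (trans (+-suc a (suc q)) (cong suc (+-suc a q))) (*-suc 2 k)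

lex≗quasiStar : ∀ a q r → r ≤ pred q → lex (a + q) (E a q + r) ≗ quasiStar a q r
lex≗quasiStar zero zero r z≤n zero    = refl
lex≗quasiStar zero zero r z≤n (suc zero)    = refl
lex≗quasiStar zero zero r z≤n (suc (suc k))    = refl
lex≗quasiStar zero (suc q) r r≤q k rewrite lex-star r≤q = go k
  where
  go : star r ≗ quasiStar 0 (suc q) r
  go zero          = refl
  go (suc zero)    rewrite W-zero q 0 = sym (*-identityʳ r)
  go (suc (suc k)) rewrite W-zero q (suc k) | W-zero (pred q) k = sym (*-zeroʳ r)
lex≗quasiStar (suc a) q r r≤ k
  rewrite +-assoc (a + q) (E a q) r =
  trans (lex-dominator (a + q) (E a q + r) k)
    (trans (D-cong (a + q) (lex≗quasiStar a q r r≤) k) (quasiStar-dominator a q r r≤ k))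

data LexView : ℕ → ℕ → Set where
  lexView : ∀ a q r → r ≤ pred q → LexView (a + q) (E a q + r)

viewLex : ∀ n e → e ≤ tri n → LexView n e
viewLex zero    zero e≤ = lexView 0 0 0 z≤n
viewLex (suc n) e    e≤ with ≤-total e n
... | inj₁ e≤n = lexView 0 (suc n) e e≤n
... | inj₂ n≤e with m≤n⇒∃[o]m+o≡n n≤e
...   | e′ , refl with viewLex n e′ (+-cancelˡ-≤ n _ _ e≤)
...     | lexView a q r r≤ =
  subst (LexView (suc (a + q))) (+-assoc (a + q) (E a q) r) (lexView (suc a) q r r≤)

-- As a function of e, lex n e (suc k) is convex: it lies above its tangent at e = E (suc a) q.
lex-tangent : ∀ a q e d k → e + d ≡ E (suc a) q →
  W (suc a) q (suc k) ≤ lex (suc a + q) e (suc k) + d * W a (pred q) k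
lex-tangent a q e d k eq with ≤-total d q
... | inj₁ d≤q = ≤-reflexive (begin
  W (suc a) q (suc k)
    ≡⟨ W-dominator k a q ⟩
  W a (suc q) (suc k) + q * W a (pred q) k
    ≡⟨ cong (λ x → W a (suc q) (suc k) + x * W a (pred q) k) (sym (m∸n+n≡m d≤q)) ⟩
  W a (suc q) (suc k) + (q ∸ d + d) * W a (pred q) k
    ≡⟨ l (W a (suc q) (suc k)) (q ∸ d) d (W a (pred q) k) ⟩
  quasiStar a (suc q) (q ∸ d) (suc k) + d * W a (pred q) k
    ≡⟨ cong (_+ d * W a (pred q) k) (sym (lex≗quasiStar a (suc q) (q ∸ d) (m∸n≤m q d) (suc k))) ⟩
  lex (a + suc q) (E a (suc q) + (q ∸ d)) (suc k) + d * W a (pred q) k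
    ≡⟨ cong₂ (λ x y → lex x y (suc k) + d * W a (pred q) k) (+-suc a q) (sym e≡) ⟩
  lex (suc a + q) e (suc k) + d * W a (pred q) k ∎)
  where
  open ≡-Reasoning
  l : ∀ z x d w → z + (x + d) * w ≡ z + x * w + d * w
  l = solve-∀
  e≡ : e ≡ E a (suc q) + (q ∸ d)
  e≡ = +-cancelʳ-≡ d e _ (trans eq (trans (E-last a q)
         (trans (cong (E a (suc q) +_) (sym (m∸n+n≡m d≤q))) (sym (+-assoc (E a (suc q)) _ d)))))
-- The last star is used up. The descent continues from the corner `E a (suc q)`, where the slope is
-- no larger by `W-mono-dominator`.
... | inj₂ q≤d with m≤n⇒∃[o]m+o≡n q≤d
lex-tangent zero q e d k eq | inj₂ q≤d | d′ , refl = begin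
  W 1 q (suc k)                          ≡⟨ W-dominator k 0 q ⟩
  W 0 (suc q) (suc k) + q * W 0 (pred q) k ≡⟨ cong (_+ q * W 0 (pred q) k) (W-zero (suc q) k) ⟩
  q * W 0 (pred q) k                     ≤⟨ *-monoˡ-≤ (W 0 (pred q) k) q≤d ⟩
  (q + d′) * W 0 (pred q) k              ≤⟨ m≤n+m _ (lex (suc q) e (suc k)) ⟩
  lex (suc q) e (suc k) + (q + d′) * W 0 (pred q) k ∎
  where open ≤-Reasoning
lex-tangent (suc a) q e d k eq | inj₂ q≤d | d′ , refl = begin
  W (suc (suc a)) q (suc k)
    ≡⟨ W-dominator k (suc a) q ⟩
  W (suc a) (suc q) (suc k) + q * σ
    ≤⟨ +-monoˡ-≤ (q * σ) (lex-tangent a (suc q) e d′ k eq′) ⟩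
  lex (suc (a + suc q)) e (suc k) + d′ * W a q k + q * σ
    ≤⟨ +-monoˡ-≤ (q * σ) (+-monoʳ-≤ (lex (suc (a + suc q)) e (suc k)) (*-monoʳ-≤ d′ (W-mono-dominator a q k))) ⟩
  lex (suc (a + suc q)) e (suc k) + d′ * σ + q * σ
    ≡⟨ l (lex (suc (a + suc q)) e (suc k)) d′ q σ ⟩
  lex (suc (a + suc q)) e (suc k) + (q + d′) * σ
    ≡⟨ cong (λ n → lex (suc n) e (suc k) + (q + d′) * σ) (+-suc a q) ⟩
  lex (suc (suc a) + q) e (suc k) + (q + d′) * σ ∎
  where
  open ≤-Reasoning
  σ : ℕ
  σ = W (suc a) (pred q) k
  l : ∀ z x q w → z + x * w + q * w ≡ z + (q + x) * w
  l = solve-∀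
  l₂ : ∀ e d q → e + (q + d) ≡ e + d + q
  l₂ = solve-∀
  eq′ : e + d′ ≡ E (suc a) (suc q)
  eq′ = +-cancelʳ-≡ q _ _ (trans (sym (l₂ e d′ q)) (trans eq (E-last (suc a) q)))

-- Take `suc a` dominating vertices. On one more vertex, e lies `suc a ∸ r` edges below the corner
-- `E (suc a) (suc q)`, and the tangent there has slope σ = `W a q k`; at e its value is
-- `W (suc a) q (suc k) + r * σ`. The smaller lex graph has the same expression with slope
-- `W (suc a) (q - 2) k`, which is at most σ because q - 2 ≤ a.
lex-addIsolated≤ : ∀ a q r → r ≤ pred q → q ≤ suc a →
  lex (suc (a + q)) (E a q + r) ⊵ lex (a + q) (E a q + r)
lex-addIsolated≤ zero q r r≤ q≤1 k = ≤-reflexive (cong (λ p → p k) (trans (cong (lex q) r≡0)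
  (trans (lex-empty q) (trans (sym (lex-empty (suc q))) (cong (lex (suc q)) (sym r≡0))))))
  where
  r≡0 : r ≡ 0
  r≡0 = n≤0⇒n≡0 (≤-trans r≤ (pred-mono-≤ q≤1))
lex-addIsolated≤ (suc a) q r r≤ q≤ zero = ≤-reflexive
  (trans (lex-zero (suc (a + q)) (E (suc a) q + r)) (sym (lex-zero (suc (suc (a + q))) (E (suc a) q + r))))
lex-addIsolated≤ (suc a) q r r≤ q≤ (suc k) = +-cancelʳ-≤ (d * σ) _ _ (begin
  lex (suc a + q) (E (suc a) q + r) (suc k) + d * σ
    ≡⟨ cong (_+ d * σ) (lex≗quasiStar (suc a) q r r≤ (suc k)) ⟩
  W (suc a) q (suc k) + r * W (suc a) (pred (pred q)) k + d * σ
    ≤⟨ +-monoˡ-≤ (d * σ) (+-monoʳ-≤ (W (suc a) q (suc k)) (slope q r r≤ q≤)) ⟩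
  W (suc a) q (suc k) + r * σ + d * σ
    ≡⟨ l (W (suc a) q (suc k)) r d σ ⟩
  W (suc a) q (suc k) + (r + d) * σ
    ≡⟨ cong (λ x → W (suc a) q (suc k) + x * σ) r+d ⟩
  W (suc a) (suc q) (suc k)
    ≤⟨ lex-tangent a (suc q) (E (suc a) q + r) d k eq ⟩
  lex (suc (a + suc q)) (E (suc a) q + r) (suc k) + d * σ
    ≡⟨ cong (λ n → lex (suc n) (E (suc a) q + r) (suc k) + d * σ) (+-suc a q) ⟩
  lex (suc (suc a + q)) (E (suc a) q + r) (suc k) + d * σ ∎)
  where
  open ≤-Reasoning
  σ d : ℕ
  σ = W a q k
  d = suc a ∸ r
  r+d : r + d ≡ suc a
  r+d = m+[n∸m]≡n (≤-trans r≤ (pred-mono-≤ q≤))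
  l : ∀ z r d w → z + r * w + d * w ≡ z + (r + d) * w
  l = solve-∀
  eq : E (suc a) q + r + d ≡ E (suc a) (suc q)
  eq = trans (+-assoc (E (suc a) q) r d) (trans (cong (E (suc a) q +_) r+d)
         (trans (+-comm (E (suc a) q) (suc a)) (sym (E-suc (suc a) q))))
  slope : ∀ q r → r ≤ pred q → q ≤ suc (suc a) → r * W (suc a) (pred (pred q)) k ≤ r * W a q k
  slope q             zero _ _ = z≤n
  slope (suc (suc q)) r    _ (s≤s (s≤s q≤a)) = *-monoʳ-≤ r (W-dominator≤ k a q q≤a)

-- On the larger vertex set the new vertex is joined to all dominating vertices, and the star pays
-- for it. If r ≥ a, the star shrinks to r - a edges; otherwise one dominating vertex is demoted to
-- centre of the star. In both cases `W-exchange` makes the two sides comparable.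
lex-addIsolated≥ : ∀ a q r → r ≤ pred q → suc a ≤ q →
  lex (a + q) (E a q + r) ⊵ lex (suc (a + q)) (E a q + r)
lex-addIsolated≥ a q r r≤ a<q k with ≤-total a r
... | inj₁ a≤r with m≤n⇒∃[o]m+o≡n a≤r
...   | x , refl = begin
  lex (suc (a + q)) (E a q + (a + x)) k   ≡⟨ cong₂ (λ m e → lex m e k) (sym (+-suc a q)) e≡ ⟩
  lex (a + suc q) (E a (suc q) + x) k     ≡⟨ lex≗quasiStar a (suc q) x x≤q k ⟩
  quasiStar a (suc q) x k                 ≤⟨ main q k r≤ ⟩
  quasiStar a q (a + x) k                 ≡⟨ sym (lex≗quasiStar a q (a + x) r≤ k) ⟩
  lex (a + q) (E a q + (a + x)) k         ∎
  where
  open ≤-Reasoning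
  e≡ : E a q + (a + x) ≡ E a (suc q) + x
  e≡ rewrite E-suc a q = l (E a q) a x
    where
    l : ∀ y a x → y + (a + x) ≡ a + y + x
    l = solve-∀
  x≤q : x ≤ q
  x≤q = ≤-trans (m≤n+m x a) (≤-trans r≤ pred[n]≤n)
  main : ∀ q k → a + x ≤ pred q → quasiStar a (suc q) x k ≤ quasiStar a q (a + x) k
  main q zero _ = ≤-refl
  main zero (suc k) h rewrite m+n≡0⇒m≡0 a (n≤0⇒n≡0 h) | m+n≡0⇒n≡0 a (n≤0⇒n≡0 h) = ≤-reflexive (+-identityʳ _)
  main (suc q) (suc k) h with m≤n⇒∃[o]m+o≡n h
  -- y is the number of edges that the star on the smaller vertex set lacks. The added term
  -- completes one side of `W-exchange`, and y copies of α ≤ γ remain.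
  ... | y , refl = +-cancelʳ-≤ (a * γ + y * α) _ _ (begin
    z + a * β + x * γ + (a * γ + y * α)
      ≤⟨ +-monoʳ-≤ (z + a * β + x * γ) (+-monoʳ-≤ (a * γ) (*-monoʳ-≤ y (α≤γ (a + x + y)))) ⟩
    z + a * β + x * γ + (a * γ + y * γ)
      ≡⟨ l₁ z (a * β) a x y γ ⟩
    z + (a * β + (a + x + y) * γ)
      ≡⟨ cong (z +_) (sym (W-exchange k a (a + x + y))) ⟩
    z + ((a + x + y) * α + a * γ)
      ≡⟨ l₂ z a x y α γ ⟩
    z + (a + x) * α + (a * γ + y * α) ∎)
    where
    α β γ z : ℕ
    α = W a (pred (a + x + y)) k
    γ = W a (a + x + y) k
    β = W (pred a) (suc (a + x + y)) k
    z = W a (suc (a + x + y)) (suc k)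
    α≤γ : ∀ q → W a (pred q) k ≤ W a q k
    α≤γ zero    = ≤-refl
    α≤γ (suc q) = W-mono-independent a q k
    l₁ : ∀ z v a x y g → z + v + x * g + (a * g + y * g) ≡ z + (v + (a + x + y) * g)
    l₁ = solve-∀
    l₂ : ∀ z a x y u g → z + ((a + x + y) * u + a * g) ≡ z + (a + x) * u + (a * g + y * u)
    l₂ = solve-∀
lex-addIsolated≥ zero q r r≤ a<q k | inj₂ r≤a =
  ≤-reflexive (cong (λ p → p k) (trans (cong (lex (suc q)) r≡0)
  (trans (lex-empty (suc q)) (trans (sym (lex-empty q)) (cong (lex q) (sym r≡0))))))
  where
  r≡0 : r ≡ 0
  r≡0 = n≤0⇒n≡0 r≤a
lex-addIsolated≥ (suc a) q r r≤ a<q k | inj₂ r≤a with m≤n⇒∃[o]m+o≡n a<q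
-- The demoted vertex has q edges to the independent vertices; a of them pay for joining the new
-- vertex to the remaining dominating vertices, and q - a = x + 2 are left for the star besides the
-- r old ones.
... | x , refl = begin
  lex (suc (suc a + q)) (E (suc a) q + r) k
    ≡⟨ cong₂ (λ m e → lex m e k) (n≡ a q) e≡ ⟩
  lex (a + suc (suc q)) (E a (suc (suc q)) + (suc (suc x) + r)) k
    ≡⟨ lex≗quasiStar a (suc (suc q)) (suc (suc x) + r) r′≤ k ⟩
  quasiStar a (suc (suc q)) (suc (suc x) + r) k
    ≤⟨ main k ⟩
  quasiStar (suc a) q r k
    ≡⟨ sym (lex≗quasiStar (suc a) q r r≤ k) ⟩
  lex (suc a + q) (E (suc a) q + r) k ∎
  where
  open ≤-Reasoning
  n≡ : ∀ a q → suc (suc a + q) ≡ a + suc (suc q)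
  n≡ = solve-∀
  e≡ : E (suc a) q + r ≡ E a (suc (suc q)) + (suc (suc x) + r)
  e≡ rewrite E-suc a (suc q) | E-suc a q = l a x r (E a q)
    where
    l : ∀ a x r y → a + (suc (suc a) + x) + y + r ≡ a + (a + y) + (suc (suc x) + r)
    l = solve-∀
  r′≤ : suc (suc x) + r ≤ suc q
  r′≤ = s≤s (s≤s (≤-trans (≤-reflexive (+-comm x r)) (+-monoˡ-≤ x r≤a)))
  main : ∀ k → quasiStar a (suc (suc q)) (suc (suc x) + r) k ≤ quasiStar (suc a) q r k
  main zero    = ≤-refl
  main (suc k) rewrite W-dominator k a q = +-cancelʳ-≤ (a * γ) _ _ (begin
    z + a * β + (suc (suc x) + r) * γ + a * γ
      ≡⟨ l₁ z (a * β) a x r γ ⟩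
    z + (a * β + q * γ) + r * γ
      ≡⟨ cong (λ s → z + s + r * γ) (sym (W-exchange k a q)) ⟩
    z + (q * α + a * γ) + r * γ
      ≤⟨ +-monoʳ-≤ (z + (q * α + a * γ)) (*-monoʳ-≤ r (W-dominator≥ k a (a + x) (m≤m+n a x))) ⟩
    z + (q * α + a * γ) + r * δ
      ≡⟨ l₂ z (q * α) (a * γ) (r * δ) ⟩
    z + q * α + r * δ + a * γ ∎)
    where
    α β γ δ z : ℕ
    α = W a (pred q) k
    γ = W a q k
    β = W (pred a) (suc q) k
    δ = W (suc a) (a + x) k
    z = W a (suc q) (suc k)
    l₁ : ∀ z v a x r g → z + v + (suc (suc x) + r) * g + a * g ≡ z + (v + (suc (suc a) + x) * g) + r * g
    l₁ = solve-∀
    l₂ : ∀ z u v w → z + (u + v) + w ≡ z + u + w + v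
    l₂ = solve-∀

-- Colex graphs: quasi-cliques, convexity and dominating vertices

-- a clique on t vertices and a further vertex joined to r of them
quasiClique : ℕ → ℕ → ℕ → ℕ
quasiClique t r zero    = 1
quasiClique t r (suc k) = W t 0 (suc k) + r * W (pred t) 0 k

-- col n e k is the number of k-matchings of C(n,e).
col : ℕ → ℕ → ℕ → ℕ
col zero    e = star 0
col (suc n) e with e ≤? tri n
... | yes _ = col n e
... | no  _ = quasiClique n (e ∸ tri n)

col-addIsolated : ∀ {n e} → e ≤ tri n → col (suc n) e ≡ col n e
col-addIsolated {n} {e} e≤ with e ≤? tri n
... | yes _  = refl
... | no  e≰ = contradiction e≤ e≰

quasiClique-full : ∀ t → quasiClique t t ≗ quasiClique (suc t) 0
quasiClique-full t zero    = refl
quasiClique-full t (suc k) = sym (+-identityʳ _)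

star≗quasiClique : star 0 ≗ quasiClique 0 0
star≗quasiClique zero          = refl
star≗quasiClique (suc zero)    = refl
star≗quasiClique (suc (suc k)) = refl

m+n≤m⇒n≡0 : ∀ m n → m + n ≤ m → n ≡ 0
m+n≤m⇒n≡0 m n m+n≤m = n≤0⇒n≡0 (+-cancelˡ-≤ m n 0 (≤-trans m+n≤m (≤-reflexive (sym (+-identityʳ m)))))

-- The delicate case is t = n, r = 0: `col` then passes to n vertices, where K_n has to be read as
-- K_(n-1) plus a vertex joined to all of it.
col≗quasiClique : ∀ n t r → r ≤ t → t < n → col n (tri t + r) ≗ quasiClique t r
col≗quasiClique (suc n) t r r≤t (s≤s t≤n) k with tri t + r ≤? tri n
... | yes e≤ with m≤n⇒m<n∨m≡n t≤n
...   | inj₁ t<n = col≗quasiClique n t r r≤t t<n k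
...   | inj₂ refl with m+n≤m⇒n≡0 (tri t) r e≤
col≗quasiClique (suc n) zero    r r≤t (s≤s t≤n) k | yes e≤ | inj₂ refl | refl = star≗quasiClique k
col≗quasiClique (suc n) (suc t) r r≤t (s≤s t≤n) k | yes e≤ | inj₂ refl | refl =
  trans (cong (λ e → col (suc t) e k) (trans (+-identityʳ _) (+-comm t (tri t))))
    (trans (col≗quasiClique (suc t) t t ≤-refl ≤-refl k) (quasiClique-full t k))
col≗quasiClique (suc n) t r r≤t (s≤s t≤n) k | no e≰ with m≤n⇒m<n∨m≡n t≤n
... | inj₁ t<n  = contradiction (≤-trans (≤-trans (+-monoʳ-≤ (tri t) r≤t) (≤-reflexive (+-comm (tri t) t))) (tri-mono t<n)) e≰
... | inj₂ refl rewrite m+n∸m≡n (tri t) r = refl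

col-full : ∀ n → col n (tri n) ≗ W n 0
col-full zero    zero          = refl
col-full zero    (suc zero)    = refl
col-full zero    (suc (suc k)) = refl
col-full (suc n) k rewrite +-comm n (tri n) =
  trans (col≗quasiClique (suc n) n n ≤-refl ≤-refl k) (lem k)
  where
  lem : quasiClique n n ≗ W (suc n) 0
  lem zero    = refl
  lem (suc k) = refl

data ColView (n : ℕ) : ℕ → Set where
  colView : ∀ t r → r ≤ t → t < n → ColView n (tri t + r)

viewCol : ∀ n e → 0 < n → e ≤ tri n → ColView n e
viewCol (suc n) e _ e≤ with ≤-total e (tri n)
viewCol (suc zero)    e _ e≤ | inj₁ e≤t rewrite n≤0⇒n≡0 e≤t = colView 0 0 z≤n (s≤s z≤n)
viewCol (suc (suc n)) e _ e≤ | inj₁ e≤t with viewCol (suc n) e (s≤s z≤n) e≤t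
... | colView t r r≤t t<n = colView t r r≤t (m≤n⇒m≤1+n t<n)
viewCol (suc n)       e _ e≤ | inj₂ t≤e with m≤n⇒∃[o]m+o≡n t≤e
... | r , refl = colView n r (+-cancelˡ-≤ (tri n) r n (≤-trans e≤ (≤-reflexive (+-comm n (tri n))))) ≤-refl

-- The left side is the tangent at K_s towards more edges. Once s edges have completed K_(s+1) the
-- slope can only grow, so the tangent may be restarted there; f counts the vertices still
-- available.
col-tangent : ∀ f s x k → tri s + x ≤ tri (s + f) →
  W s 0 (suc k) + x * W (pred s) 0 k ≤ col (s + f) (tri s + x) (suc k)
col-tangent zero s x k e≤ rewrite +-identityʳ s | m+n≤m⇒n≡0 (tri s) x e≤ | +-identityʳ (tri s) =
  ≤-reflexive (trans (+-identityʳ _) (sym (col-full s (suc k))))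
col-tangent (suc f) s x k e≤ with ≤-total x s
... | inj₁ x≤s = ≤-reflexive (sym (col≗quasiClique (s + suc f) s x x≤s (m<m+n s (s≤s z≤n)) (suc k)))
... | inj₂ s≤x with m≤n⇒∃[o]m+o≡n s≤x
...   | y , refl = begin
  W s 0 (suc k) + (s + y) * W (pred s) 0 k
    ≡⟨ l₁ (W s 0 (suc k)) s y (W (pred s) 0 k) ⟩
  W (suc s) 0 (suc k) + y * W (pred s) 0 k
    ≤⟨ +-monoʳ-≤ (W (suc s) 0 (suc k)) (*-monoʳ-≤ y (lem s)) ⟩
  W (suc s) 0 (suc k) + y * W s 0 k
    ≤⟨ col-tangent f (suc s) y k (≤-trans (≤-reflexive (l₂ s (tri s) y)) (≤-trans e≤ (≤-reflexive (cong tri (+-suc s f))))) ⟩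
  col (suc s + f) (tri (suc s) + y) (suc k)
    ≡⟨ cong₂ (λ n e → col n e (suc k)) (sym (+-suc s f)) (l₂ s (tri s) y) ⟩
  col (s + suc f) (tri s + (s + y)) (suc k) ∎
  where
  open ≤-Reasoning
  l₁ : ∀ z s y w → z + (s + y) * w ≡ z + s * w + y * w
  l₁ = solve-∀
  l₂ : ∀ s t y → s + t + y ≡ t + (s + y)
  l₂ = solve-∀
  lem : ∀ s → W (pred s) 0 k ≤ W s 0 k
  lem zero    = ≤-refl
  lem (suc s) = W-mono-dominator s 0 k

D-quasiClique₁ : ∀ t j r →
  D (suc (t + j)) (quasiClique t r) 1 ≡ W (suc t) 0 1 + suc j * W t 0 0 + r
D-quasiClique₁ t j r = l (W t 0 1) t j r
  where
  l : ∀ x t j r → x + r * 1 + suc (t + j) * 1 ≡ x + t * 1 + suc j * 1 + r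
  l = solve-∀

-- The vertices are K_t, a vertex y of degree r, j isolated vertices and the dominator. The terms
-- count matchings inside the clique formed by K_t and the dominator; those where the dominator goes
-- to y or an isolated vertex and y is not matched into K_t; and those where y is matched into K_t,
-- the dominator then staying in the clique or taking an isolated vertex.
D-quasiClique : ∀ t j r k → r ≤ t →
  D (suc (t + j)) (quasiClique t r) (suc (suc k)) ≡
  W (suc t) 0 (suc (suc k)) + suc j * W t 0 (suc k) + r * (W t 0 (suc k) + j * W (pred t) 0 k)
D-quasiClique zero    j zero k z≤n = l (suc j ∸ 2 * suc k) j
  where
  l : ∀ x j → 0 + x * 0 ≡ 0 + suc j * 0 + 0
  l = solve-∀
D-quasiClique (suc t) j r k r≤t = begin
  x + r * y + (suc (suc (t + j)) ∸ 2 * suc k) * (y′ + r * w)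
    ≡⟨ l₁ x r y (suc (suc (t + j)) ∸ 2 * suc k) y′ w ⟩
  x + r * y + (suc (suc (t + j)) ∸ 2 * suc k) * y′ + r * ((suc (suc (t + j)) ∸ 2 * suc k) * w)
    ≡⟨ cong₂ (λ s u → x + r * y + s + r * u) eq₁ eq₂ ⟩
  x + r * y + (suc t * y + 0 + suc j * y′) + r * (t * v + 0 + j * w)
    ≡⟨ l₂ x r y t j y′ v w ⟩
  x + suc t * y + suc j * y′ + r * (y + t * v + j * w) ∎
  where
  open ≡-Reasoning
  x y y′ v w : ℕ
  x  = W (suc t) 0 (suc (suc k))
  y  = W t 0 (suc k)
  y′ = W (suc t) 0 (suc k)
  v  = W (pred t) 0 k
  w  = W t 0 k
  eq₁ : (suc (suc (t + j)) ∸ 2 * suc k) * y′ ≡ suc t * y + 0 + suc j * y′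
  eq₁ = trans (cong (λ n → (n ∸ 2 * suc k) * y′) (l t j)) (W-uncovered (suc t) 0 (suc j) (suc k))
    where
    l : ∀ t j → suc (suc (t + j)) ≡ suc t + 0 + suc j
    l = solve-∀
  eq₂ : (suc (suc (t + j)) ∸ 2 * suc k) * w ≡ t * v + 0 + j * w
  eq₂ = trans (cong (_* w) (trans (cong (suc (suc (t + j)) ∸_) (*-suc 2 k)) (cong (λ n → n + j ∸ 2 * k) (sym (+-identityʳ t)))))
          (W-uncovered t 0 j k)
  l₁ : ∀ x r y n y′ w → x + r * y + n * (y′ + r * w) ≡ x + r * y + n * y′ + r * (n * w)
  l₁ = solve-∀
  l₂ : ∀ x r y t j y′ v w → x + r * y + (suc t * y + 0 + suc j * y′) + r * (t * v + 0 + j * w) ≡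
                           x + suc t * y + suc j * y′ + r * (y + t * v + j * w)
  l₂ = solve-∀

-- With j = t + i, the n + e edges exceed those of K_(t+2) by i + r, so the tangent of colex at
-- K_(t+2) applies. Against `D-quasiClique` the two sides differ only in r * i versus t * i.
col-addDominator≤ : ∀ t j r → r ≤ t → t ≤ j →
  col (suc (suc (t + j))) (suc (t + j) + (tri t + r)) ⊵ D (suc (t + j)) (col (suc (t + j)) (tri t + r))
col-addDominator≤ t j r r≤t t≤j k with m≤n⇒∃[o]m+o≡n t≤j
... | i , refl = begin
  D n (col n (tri t + r)) k
    ≡⟨ D-cong n (col≗quasiClique n t r r≤t (s≤s (m≤m+n t j))) k ⟩
  D n (quasiClique t r) k
    ≤⟨ main k ⟩
  col (suc n) (n + (tri t + r)) k ∎
  where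
  open ≤-Reasoning
  n : ℕ
  n = suc (t + j)
  col-zero : ∀ n e → col n e 0 ≡ 1
  col-zero zero e = refl
  col-zero (suc n) e with e ≤? tri n
  ... | yes _ = col-zero n e
  ... | no  _ = refl
  n≡ : ∀ t i → suc (suc t) + (t + i) ≡ suc (suc (t + (t + i)))
  n≡ = solve-∀
  tangent : ∀ k → W (suc (suc t)) 0 (suc k) + (i + r) * W (suc t) 0 k ≤ col (suc n) (n + (tri t + r)) (suc k)
  tangent k = ≤-trans (col-tangent (t + i) (suc (suc t)) (i + r) k bound)
    (≤-reflexive (cong₂ (λ m e → col m e (suc k)) (n≡ t i) (l t i (tri t) r)))
    where
    l : ∀ t i T r → suc t + (t + T) + (i + r) ≡ suc (t + (t + i)) + (T + r)
    l = solve-∀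
    bound : tri (suc (suc t)) + (i + r) ≤ tri (suc (suc t) + (t + i))
    bound = begin
      suc t + (t + tri t) + (i + r)   ≡⟨ l t i (tri t) r ⟩
      n + (tri t + r)                 ≤⟨ +-monoʳ-≤ n (+-monoʳ-≤ (tri t) r≤t) ⟩
      n + (tri t + t)                 ≡⟨ cong (n +_) (+-comm (tri t) t) ⟩
      n + tri (suc t)                 ≤⟨ +-monoʳ-≤ n (tri-mono (s≤s (m≤m+n t j))) ⟩
      tri (suc n)                     ≡⟨ cong tri (sym (n≡ t i)) ⟩
      tri (suc (suc t) + (t + i)) ∎
  main : ∀ k → D n (quasiClique t r) k ≤ col (suc n) (n + (tri t + r)) k
  main zero = ≤-reflexive (sym (col-zero (suc n) (n + (tri t + r))))
  main (suc zero) = ≤-trans (≤-reflexive (trans (D-quasiClique₁ t j r) (l (W (suc t) 0 1) t i r))) (tangent 0)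
    where
    l : ∀ x t i r → x + suc (t + i) * 1 + r ≡ x + suc t * 1 + (i + r) * 1
    l = solve-∀
  main (suc (suc k)) = begin
    D n (quasiClique t r) (suc (suc k))
      ≡⟨ D-quasiClique t j r k r≤t ⟩
    x + suc j * y + r * (y + j * w)
      ≡⟨ l₁ x t i y r w ⟩
    x + suc t * y + (i + r) * y + r * t * w + r * (i * w)
      ≤⟨ +-monoʳ-≤ (x + suc t * y + (i + r) * y + r * t * w) (*-monoˡ-≤ (i * w) r≤t) ⟩
    x + suc t * y + (i + r) * y + r * t * w + t * (i * w)
      ≡⟨ l₂ x t i y r w ⟩
    x + suc t * y + (i + r) * (y + t * w)
      ≤⟨ tangent (suc k) ⟩
    col (suc n) (n + (tri t + r)) (suc (suc k)) ∎
    where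
    x y w : ℕ
    x = W (suc t) 0 (suc (suc k))
    y = W t 0 (suc k)
    w = W (pred t) 0 k
    l₁ : ∀ x t i y r w → x + suc (t + i) * y + r * (y + (t + i) * w) ≡
                         x + suc t * y + (i + r) * y + r * t * w + r * (i * w)
    l₁ = solve-∀
    l₂ : ∀ x t i y r w → x + suc t * y + (i + r) * y + r * t * w + t * (i * w) ≡
                         x + suc t * y + (i + r) * (y + t * w)
    l₂ = solve-∀

-- The larger colex graph is K_(t+1) plus a vertex of degree j + 1 + r if j + r ≤ t, and otherwise
-- K_(t+2) plus a vertex of degree x = j + r - t. In the second case j ≤ t gives x ≤ r, which
-- decides the comparison with `D-quasiClique`.
col-addDominator≥ : ∀ t j r → r ≤ t → j ≤ t →
  D (suc (t + j)) (col (suc (t + j)) (tri t + r)) ⊵ col (suc (suc (t + j))) (suc (t + j) + (tri t + r))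
col-addDominator≥ t j r r≤t j≤t k = ≤-trans (main k)
  (≤-reflexive (sym (D-cong n (col≗quasiClique n t r r≤t (s≤s (m≤m+n t j))) k)))
  where
  open ≤-Reasoning
  n : ℕ
  n = suc (t + j)
  e≡ : ∀ t j T r → suc (t + j) + (T + r) ≡ t + T + (suc j + r)
  e≡ = solve-∀
  below : ∀ k → quasiClique (suc t) (suc j + r) k ≤ D n (quasiClique t r) k
  below zero          = ≤-refl
  below (suc zero)    = ≤-reflexive (trans (l (W (suc t) 0 1) j r) (sym (D-quasiClique₁ t j r)))
    where
    l : ∀ x j r → x + (suc j + r) * 1 ≡ x + suc j * 1 + r
    l = solve-∀
  below (suc (suc k)) = begin
    x + (suc j + r) * y             ≤⟨ m≤m+n _ (r * (j * w)) ⟩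
    x + (suc j + r) * y + r * (j * w) ≡⟨ l x j r y w ⟩
    x + suc j * y + r * (y + j * w) ≡⟨ sym (D-quasiClique t j r k r≤t) ⟩
    D n (quasiClique t r) (suc (suc k)) ∎
    where
    x y w : ℕ
    x = W (suc t) 0 (suc (suc k))
    y = W t 0 (suc k)
    w = W (pred t) 0 k
    l : ∀ x j r y w → x + (suc j + r) * y + r * (j * w) ≡ x + suc j * y + r * (y + j * w)
    l = solve-∀
  above : ∀ x → j + r ≡ t + x → x ≤ r → ∀ k → quasiClique (suc (suc t)) x k ≤ D n (quasiClique t r) k
  above x eq x≤r zero       = ≤-refl
  above x eq x≤r (suc zero) = ≤-reflexive (trans (l₁ z t x)
    (trans (cong (λ s → z + suc s) (sym eq)) (trans (l₂ z j r) (sym (D-quasiClique₁ t j r)))))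
    where
    z : ℕ
    z = W (suc t) 0 1
    l₁ : ∀ z t x → z + suc t * 1 + x * 1 ≡ z + suc (t + x)
    l₁ = solve-∀
    l₂ : ∀ z j r → z + suc (j + r) ≡ z + suc j * 1 + r
    l₂ = solve-∀
  above x eq x≤r (suc (suc k)) with m≤n⇒∃[o]m+o≡n r≤t
  ... | i , refl = begin
    z + suc t * y + x * (y + t * w)           ≡⟨ l₁ z r i x y w ⟩
    z + suc (r + i + x) * y + r * (x * w) + x * (i * w)
      ≤⟨ +-monoʳ-≤ (z + suc (r + i + x) * y + r * (x * w)) (*-monoˡ-≤ (i * w) x≤r) ⟩
    z + suc (r + i + x) * y + r * (x * w) + r * (i * w)
      ≡⟨ l₂ z r i x y w ⟩
    z + suc (x + i) * y + r * (y + (x + i) * w)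
      ≡⟨ cong (λ s → z + suc s * y + r * (y + s * w)) (sym j≡) ⟩
    z + suc j * y + r * (y + j * w)           ≡⟨ sym (D-quasiClique t j r k r≤t) ⟩
    D n (quasiClique t r) (suc (suc k)) ∎
    where
    z y w : ℕ
    z = W (suc t) 0 (suc (suc k))
    y = W t 0 (suc k)
    w = W (pred t) 0 k
    j≡ : j ≡ x + i
    j≡ = +-cancelʳ-≡ r j (x + i) (trans eq (l r i x))
      where
      l : ∀ r i x → r + i + x ≡ x + i + r
      l = solve-∀
    l₁ : ∀ z r i x y w → z + suc (r + i) * y + x * (y + (r + i) * w) ≡
                         z + suc (r + i + x) * y + r * (x * w) + x * (i * w)
    l₁ = solve-∀
    l₂ : ∀ z r i x y w → z + suc (r + i + x) * y + r * (x * w) + r * (i * w) ≡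
                         z + suc (x + i) * y + r * (y + (x + i) * w)
    l₂ = solve-∀
  main : ∀ k → col (suc n) (n + (tri t + r)) k ≤ D n (quasiClique t r) k
  main k with j + r ≤? t
  ... | yes j+r≤t = ≤-trans (≤-reflexive (trans (cong (λ e → col (suc n) e k) (e≡ t j (tri t) r))
    (col≗quasiClique (suc n) (suc t) (suc j + r) (s≤s j+r≤t) (s≤s (s≤s (m≤m+n t j))) k))) (below k)
  ... | no j+r≰t with m≤n⇒∃[o]m+o≡n (<⇒≤ (≰⇒> j+r≰t))
  ...   | x , eq = ≤-trans (≤-reflexive (trans (cong (λ e → col (suc n) e k) e≡′)
    (col≗quasiClique (suc n) (suc (suc t)) x x≤ (s≤s (s≤s (m<m+n t 0<j))) k))) (above x (sym eq) x≤r k)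
    where
    x≤r : x ≤ r
    x≤r = +-cancelˡ-≤ t x r (≤-trans (≤-reflexive eq) (+-monoˡ-≤ r j≤t))
    x≤ : x ≤ suc (suc t)
    x≤ = ≤-trans x≤r (m≤n⇒m≤1+n (m≤n⇒m≤1+n r≤t))
    0<j : 0 < j
    0<j = n≢0⇒n>0 λ { refl → j+r≰t r≤t }
    e≡′ : n + (tri t + r) ≡ tri (suc (suc t)) + x
    e≡′ = trans (e≡ t j (tri t) r) (trans (cong (λ s → t + tri t + suc s) (sym eq)) (l t (tri t) x))
      where
      l : ∀ t T x → t + T + suc (t + x) ≡ suc t + (t + T) + x
      l = solve-∀

-- Descents between colex and lex

col-fewEdges : ∀ n t r → r ≤ t → suc (t + t) ≤ n →
  col (suc n) (n + (tri t + r)) ⊵ D n (col n (tri t + r))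
col-fewEdges n t r r≤t 2t<n with m≤n⇒∃[o]m+o≡n (≤-trans (s≤s (m≤m+n t t)) 2t<n)
... | j , refl = col-addDominator≤ t j r r≤t (+-cancelˡ-≤ (suc t) t j 2t<n)

quasiClique⊵star : ∀ t r → quasiClique t r ⊵ star (tri t + r)
quasiClique⊵star t r zero          = ≤-refl
quasiClique⊵star t r (suc zero)    = ≤-reflexive (cong₂ _+_ (sym (W-edges t)) (sym (*-identityʳ r)))
quasiClique⊵star t r (suc (suc k)) = z≤n

-- Few edges: trading an isolated vertex for a dominating one repeatedly leads from colex down to lex.
col⊵lex : ∀ n t r → r ≤ t → t < n → suc (t + t) ≤ n → tri t + r ≤ tri n →
  col n (tri t + r) ⊵ lex n (tri t + r)
col⊵lex (suc m) t r r≤t t<n (s≤s 2t≤m) e≤ with ≤-<-connex (tri t + r) m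
... | inj₁ e≤m = λ k → begin
  lex (suc m) (tri t + r) k   ≡⟨ cong (λ p → p k) (lex-star e≤m) ⟩
  star (tri t + r) k          ≤⟨ quasiClique⊵star t r k ⟩
  quasiClique t r k           ≡⟨ sym (col≗quasiClique (suc m) t r r≤t t<n k) ⟩
  col (suc m) (tri t + r) k   ∎
  where open ≤-Reasoning
... | inj₂ m<e with m≤n⇒∃[o]m+o≡n (<⇒≤ m<e)
... | e′ , eq = subst (λ e → col (suc m) e ⊵ lex (suc m) e) eq (go (viewCol m e′ 0<m e′≤) eq)
  where
  0<m : 0 < m
  0<m = n≢0⇒n>0 λ { refl → <⇒≱ m<e e≤ }
  e′≤ : e′ ≤ tri m
  e′≤ = +-cancelˡ-≤ m _ _ (≤-trans (≤-reflexive eq) e≤)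
  go : ∀ {e′} → ColView m e′ → m + e′ ≡ tri t + r →
       col (suc m) (m + e′) ⊵ lex (suc m) (m + e′)
  go (colView t′ r′ r′≤t′ t′<m) eq =
    ⊵-trans (col-fewEdges m t′ r′ r′≤t′ 2t′<m)
      (⊵-trans (D-mono m (col⊵lex m t′ r′ r′≤t′ t′<m 2t′<m e″≤))
        (≗⇒⊵ λ k → sym (lex-dominator m (tri t′ + r′) k)))
    where
    open ≤-Reasoning
    -- The clique must shrink: if t ≤ t′, then m + tri t edges fit into tri t + t, so m ≤ t, against
    -- 2t ≤ m and 0 < m. Now t′ < t carries the hypothesis on n to the next round.
    m≤t : t ≤ t′ → m ≤ t
    m≤t t≤t′ = +-cancelˡ-≤ (tri t) m t (begin
      tri t + m          ≡⟨ +-comm (tri t) m ⟩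
      m + tri t          ≤⟨ +-monoʳ-≤ m (tri-mono t≤t′) ⟩
      m + tri t′         ≤⟨ +-monoʳ-≤ m (m≤m+n (tri t′) r′) ⟩
      m + (tri t′ + r′)  ≡⟨ eq ⟩
      tri t + r              ≤⟨ +-monoʳ-≤ (tri t) r≤t ⟩
      tri t + t              ∎)
    t′<t : t′ < t
    t′<t = ≰⇒> λ t≤t′ → <⇒≱ 0<m (≤-trans (m≤t t≤t′)
      (≤-reflexive (m+n≤m⇒n≡0 t t (≤-trans 2t≤m (m≤t t≤t′)))))
    2t′<m : suc (t′ + t′) ≤ m
    2t′<m = ≤-trans (+-mono-≤ t′<t (<⇒≤ t′<t)) 2t≤m
    e″≤ : tri t′ + r′ ≤ tri m
    e″≤ = +-cancelˡ-≤ m _ _ (≤-trans (≤-reflexive eq) e≤)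

col-addDominator : ∀ n e → e ≤ tri n →
  D n (col n e) ⊵ lex (suc n) (n + e) ⊎ D n (col n e) ⊵ col (suc n) (n + e)
col-addDominator zero zero e≤ = inj₁ λ k → ≤-reflexive (D-star-zero 0 k)
col-addDominator (suc n) e e≤ with viewCol (suc n) e (s≤s z≤n) e≤
... | colView t r r≤t t<n with m≤n⇒∃[o]m+o≡n t<n
...   | j , refl with ≤-total j t
...     | inj₁ j≤t = inj₂ (col-addDominator≥ t j r r≤t j≤t)
...     | inj₂ t≤j = inj₁ (⊵-trans
  (D-mono (suc (t + j)) (col⊵lex (suc (t + j)) t r r≤t t<n (s≤s (+-monoʳ-≤ t t≤j)) e≤))
  (≗⇒⊵ λ k → sym (lex-dominator (suc (t + j)) (tri t + r) k)))

E-tri : ∀ a → E a 1 ≡ tri (suc a)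
E-tri zero    = refl
E-tri (suc a) = cong₂ _+_ (+-comm a 1) (E-tri a)

E-mono : ∀ d a q → E a (d + q) ≤ E (d + a) q
E-mono zero    a q = ≤-refl
E-mono (suc d) a q = ≤-trans (≤-trans (m≤m+n _ (d + q)) (≤-reflexive (sym (E-last a (d + q)))))
  (≤-trans (E-mono d (suc a) q) (≤-reflexive (cong (λ x → E x q) (+-suc d a))))

-- In this range colex is linear in e, and its line is the tangent of lex at the complete graph:
-- both have slope `W n 0 k`.
lex-nearComplete : ∀ n x → x ≤ suc n →
  lex (suc (suc n)) (tri (suc n) + x) ⊵ col (suc (suc n)) (tri (suc n) + x)
lex-nearComplete n x x≤n k = ≤-trans
  (≤-reflexive (col≗quasiClique (suc (suc n)) (suc n) x x≤n ≤-refl k)) (main k)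
  where
  open ≤-Reasoning
  main : ∀ k → quasiClique (suc n) x k ≤ lex (suc (suc n)) (tri (suc n) + x) k
  main zero    = ≤-reflexive (sym (lex-zero (suc (suc n)) (tri (suc n) + x)))
  main (suc k) with m≤n⇒∃[o]m+o≡n x≤n
  ... | d , x+d = +-cancelʳ-≤ (d * W n 0 k) _ _ (begin
    W (suc n) 0 (suc k) + x * W n 0 k + d * W n 0 k
      ≡⟨ l (W (suc n) 0 (suc k)) x d (W n 0 k) ⟩
    W (suc n) 0 (suc k) + (x + d) * W n 0 k
      ≡⟨ cong (λ s → W (suc n) 0 (suc k) + s * W n 0 k) x+d ⟩
    W (suc (suc n)) 0 (suc k)
      ≡⟨⟩
    W (suc n) 1 (suc k)
      ≤⟨ lex-tangent n 1 (tri (suc n) + x) d k eq ⟩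
    lex (suc n + 1) (tri (suc n) + x) (suc k) + d * W n 0 k
      ≡⟨ cong (λ m → lex m (tri (suc n) + x) (suc k) + d * W n 0 k) (+-comm (suc n) 1) ⟩
    lex (suc (suc n)) (tri (suc n) + x) (suc k) + d * W n 0 k ∎)
    where
    l : ∀ z x d w → z + x * w + d * w ≡ z + (x + d) * w
    l = solve-∀
    eq : tri (suc n) + x + d ≡ E (suc n) 1
    eq = trans (+-assoc (tri (suc n)) x d) (trans (cong (tri (suc n) +_) x+d)
           (trans (+-comm (tri (suc n)) (suc n)) (sym (E-tri (suc n)))))

-- Many edges: removing an isolated vertex repeatedly leads from lex down to colex.
lex⊵col : ∀ n e a q → e ≤ tri n → n ≡ suc (a + q) → q ≤ a → E a (suc q) ≤ e → lex n e ⊵ col n e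
lex⊵col (suc zero)    zero a q e≤ _ _ _ k = ≤-refl
lex⊵col (suc (suc n)) e a q e≤ n≡ q≤a E≤e with ≤-total e (tri (suc n))
... | inj₂ ≤e with m≤n⇒∃[o]m+o≡n ≤e
...   | x , refl = lex-nearComplete n x
  (+-cancelˡ-≤ (tri (suc n)) x (suc n) (≤-trans e≤ (≤-reflexive (+-comm (suc n) (tri (suc n))))))
-- For q = 0 the lower bound on e already forces the complete graph, so the descent ends before q
-- runs out.
lex⊵col (suc (suc n)) e a zero e≤ n≡ q≤a E≤e | inj₁ e≤′ =
  contradiction (≤-trans (≤-reflexive (cong tri n≡′)) (≤-trans (≤-reflexive (sym (E-tri a))) (≤-trans E≤e e≤′)))
    (<⇒≱ (m<n+m (tri (suc n)) {suc n} (s≤s z≤n)))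
  where
  n≡′ : suc (suc n) ≡ suc a
  n≡′ = trans n≡ (cong suc (+-identityʳ a))
lex⊵col (suc (suc n)) e a (suc q) e≤ n≡ q<a E≤e | inj₁ e≤′ =
  ⊵-trans (step (viewLex (suc n) e e≤′) refl refl)
    (⊵-trans (lex⊵col (suc n) e a q e≤′ n≡′ (<⇒≤ q<a) (≤-trans (m≤n+m (E a (suc q)) a) a+E≤e))
      (≗⇒⊵ λ k → sym (cong (λ p → p k) (col-addIsolated e≤′))))
  where
  n≡′ : suc n ≡ suc (a + q)
  n≡′ = trans (suc-injective n≡) (+-suc a q)
  a+E≤e : a + E a (suc q) ≤ e
  a+E≤e = ≤-trans (≤-reflexive (sym (E-suc a (suc q)))) E≤e
  -- The threshold of `lex-addIsolated≤` holds because e is large. Otherwise a′ < a, since a′ + q′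
  -- is fixed, and then e ≤ `E (suc a′) (q′ - 1)` ≤ `E a (suc q)`, which is a edges short.
  absurd : ∀ a′ q′ r′ → r′ ≤ pred q′ → a′ + q′ ≡ suc n → E a′ q′ + r′ ≡ e → ¬ suc a′ < q′
  absurd a′ (suc q′) r′ r′≤ m≡ e≡ (s≤s a′<q′) with m≤n⇒∃[o]m+o≡n a′<a
    where
    a′<a : a′ < a
    a′<a = ≰⇒> λ a≤a′ → <⇒≢ (+-mono-≤-< a≤a′ (≤-trans (s≤s (≤-trans q<a a≤a′)) (m≤n⇒m≤1+n a′<q′)))
      (sym (trans m≡ (trans n≡′ (sym (+-suc a q)))))
  ... | d , refl = <⇒≱ (m<n+m (E a (suc q)) {a} (s≤s z≤n)) (begin
    a + E a (suc q)                ≤⟨ a+E≤e ⟩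
    e                              ≡⟨ sym e≡ ⟩
    E a′ (suc q′) + r′             ≤⟨ +-monoʳ-≤ (E a′ (suc q′)) r′≤ ⟩
    E a′ (suc q′) + q′             ≡⟨ sym (E-last a′ q′) ⟩
    E (suc a′) q′                  ≡⟨ cong (E (suc a′)) q′≡ ⟩
    E (suc a′) (d + suc q)         ≤⟨ E-mono d (suc a′) (suc q) ⟩
    E (d + suc a′) (suc q)         ≡⟨ cong (λ x → E x (suc q)) (+-comm d (suc a′)) ⟩
    E a (suc q)                    ∎)
    where
    open ≤-Reasoning
    q′≡ : q′ ≡ d + suc q
    q′≡ = +-cancelˡ-≡ (suc a′) q′ (d + suc q)
      (trans (sym (+-suc a′ q′)) (trans m≡ (trans n≡′ (l a′ d q))))
      where
      l : ∀ a′ d q → suc (suc a′ + d + q) ≡ suc a′ + (d + suc q)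
      l = solve-∀
  step : ∀ {m e′} → LexView m e′ → m ≡ suc n → e′ ≡ e → lex (suc m) e′ ⊵ lex m e′
  step (lexView a′ q′ r′ r′≤) m≡ e≡ = lex-addIsolated≤ a′ q′ r′ r′≤ (≮⇒≥ λ a′+1<q′ → absurd a′ q′ r′ r′≤ m≡ e≡ a′+1<q′)

lex-addIsolated : ∀ n e → e ≤ tri n → lex n e ⊵ lex (suc n) e ⊎ lex n e ⊵ col (suc n) e
lex-addIsolated n e e≤ with viewLex n e e≤
... | lexView a q r r≤ with ≤-total (suc a) q
...   | inj₁ a<q = inj₁ (lex-addIsolated≥ a q r r≤ a<q)
...   | inj₂ q≤1+a = inj₂ (⊵-trans (go a q q≤1+a e≤) (≗⇒⊵ λ k → sym (cong (λ p → p k) (col-addIsolated e≤))))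
  where
  go : ∀ a q → q ≤ suc a → E a q + r ≤ tri (a + q) → lex (a + q) (E a q + r) ⊵ col (a + q) (E a q + r)
  go a       (suc q) (s≤s q≤a) e≤ = lex⊵col _ _ a q e≤ (+-suc a q) q≤a (m≤m+n _ r)
  -- In a complete graph the last vertex can be counted as the single independent one.
  go (suc a) zero    _         e≤ = lex⊵col _ _ a 0 e≤ refl z≤n (≤-trans (E-mono 1 a 0) (m≤m+n _ r))
  go zero    zero    _         e≤ k = ≤-refl

-- Counting matchings along a list of vertices

⟦_⟧ : Bool → ℕ
⟦ false ⟧ = 0
⟦ true ⟧  = 1

⟦⟧≤1 : ∀ b → ⟦ b ⟧ ≤ 1
⟦⟧≤1 false = z≤n
⟦⟧≤1 true  = ≤-refl

module _ {V : Set} where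

  -- S a f vs is the sum of a u * f (vs without u) over the entries u of vs.
  S : (V → ℕ) → (List V → ℕ) → List V → ℕ
  S a f []       = 0
  S a f (u ∷ us) = a u * f us + S a (f ∘ (u ∷_)) us

  S-cong : ∀ {P : V → Set} {a b f g vs} → All P vs →
    (∀ {u} → P u → a u ≡ b u) → (∀ {r} → All P r → f r ≡ g r) → S a f vs ≡ S b g vs
  S-cong []       ab fg = refl
  S-cong (p ∷ ps) ab fg = cong₂ _+_ (cong₂ _*_ (ab p) (fg ps)) (S-cong ps ab (λ qs → fg (p ∷ qs)))

  S-congʳ : ∀ {a f g} → (∀ r → f r ≡ g r) → ∀ vs → S a f vs ≡ S a g vs
  S-congʳ     fg []       = refl
  S-congʳ {a} fg (u ∷ us) = cong₂ _+_ (cong (a u *_) (fg us)) (S-congʳ (fg ∘ (u ∷_)) us)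

  S-congˡ : ∀ {a b f} → (∀ u → a u ≡ b u) → ∀ vs → S a f vs ≡ S b f vs
  S-congˡ         ab []       = refl
  S-congˡ {f = f} ab (u ∷ us) = cong₂ _+_ (cong (_* f us) (ab u)) (S-congˡ ab us)

  S-+ʳ : ∀ a f g vs → S a (λ r → f r + g r) vs ≡ S a f vs + S a g vs
  S-+ʳ a f g []       = refl
  S-+ʳ a f g (u ∷ us) rewrite S-+ʳ a (f ∘ (u ∷_)) (g ∘ (u ∷_)) us =
    l (a u) (f us) (g us) (S a (f ∘ (u ∷_)) us) (S a (g ∘ (u ∷_)) us)
    where
    l : ∀ x y z v w → x * (y + z) + (v + w) ≡ x * y + v + (x * z + w)
    l = solve-∀

  S-+ˡ : ∀ a b f vs → S (λ u → a u + b u) f vs ≡ S a f vs + S b f vs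
  S-+ˡ a b f []       = refl
  S-+ˡ a b f (u ∷ us) rewrite S-+ˡ a b (f ∘ (u ∷_)) us =
    l (a u) (b u) (f us) (S a (f ∘ (u ∷_)) us) (S b (f ∘ (u ∷_)) us)
    where
    l : ∀ x y z v w → (x + y) * z + (v + w) ≡ x * z + v + (y * z + w)
    l = solve-∀

  S-*ʳ : ∀ a c f vs → S a (λ r → c * f r) vs ≡ c * S a f vs
  S-*ʳ a c f []       = sym (*-zeroʳ c)
  S-*ʳ a c f (u ∷ us) rewrite S-*ʳ a c (f ∘ (u ∷_)) us = l (a u) c (f us) (S a (f ∘ (u ∷_)) us)
    where
    l : ∀ x c y z → x * (c * y) + c * z ≡ c * (x * y + z)
    l = solve-∀

  S-mono : ∀ {a b} f → (∀ u → a u ≤ b u) → ∀ vs → S a f vs ≤ S b f vs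
  S-mono f ab []       = z≤n
  S-mono f ab (u ∷ us) = +-mono-≤ (*-monoˡ-≤ (f us) (ab u)) (S-mono _ ab us)

  S-cons : ∀ a b f u us → S a (S b f) (u ∷ us) ≡
    a u * S b f us + b u * S a f us + S a (S b (f ∘ (u ∷_))) us
  S-cons a b f u us = begin
    a u * S b f us + S a (λ r → b u * f r + S b (f ∘ (u ∷_)) r) us
      ≡⟨ cong (a u * S b f us +_) (S-+ʳ a (λ r → b u * f r) (S b (f ∘ (u ∷_))) us) ⟩
    a u * S b f us + (S a (λ r → b u * f r) us + S a (S b (f ∘ (u ∷_))) us)
      ≡⟨ cong (λ s → a u * S b f us + (s + S a (S b (f ∘ (u ∷_))) us)) (S-*ʳ a (b u) f us) ⟩
    a u * S b f us + (b u * S a f us + S a (S b (f ∘ (u ∷_))) us)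
      ≡⟨ sym (+-assoc (a u * S b f us) _ _) ⟩
    a u * S b f us + b u * S a f us + S a (S b (f ∘ (u ∷_))) us ∎
    where open ≡-Reasoning

  S-comm : ∀ a b f vs → S a (S b f) vs ≡ S b (S a f) vs
  S-comm a b f []       = refl
  S-comm a b f (u ∷ us) = begin
    S a (S b f) (u ∷ us)
      ≡⟨ S-cons a b f u us ⟩
    a u * S b f us + b u * S a f us + S a (S b (f ∘ (u ∷_))) us
      ≡⟨ cong₂ _+_ (+-comm (a u * S b f us) _) (S-comm a b (f ∘ (u ∷_)) us) ⟩
    b u * S a f us + a u * S b f us + S b (S a (f ∘ (u ∷_))) us
      ≡⟨ sym (S-cons b a f u us) ⟩
    S b (S a f) (u ∷ us) ∎
    where open ≡-Reasoning

  S-↭ : ∀ a {f} → (∀ {r s} → r ↭ s → f r ≡ f s) → ∀ {us vs} → us ↭ vs → S a f us ≡ S a f vs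
  S-↭ a     ff refl          = refl
  S-↭ a     ff (prep x p)    = cong₂ _+_ (cong (a x *_) (ff p)) (S-↭ a (ff ∘ prep x) p)
  S-↭ a {f} ff (swap {xs} {ys} x y p) = begin
    a x * f (y ∷ xs) + (a y * f (x ∷ xs) + S a (λ r → f (x ∷ y ∷ r)) xs)
      ≡⟨ cong₂ _+_ (cong (a x *_) (ff (prep y p))) (cong₂ _+_ (cong (a y *_) (ff (prep x p)))
           (trans (S-congʳ (λ r → ff (swap x y refl)) xs) (S-↭ a (ff ∘ prep y ∘ prep x) p))) ⟩
    a x * f (y ∷ ys) + (a y * f (x ∷ ys) + S a (λ r → f (y ∷ x ∷ r)) ys)
      ≡⟨ l (a x * f (y ∷ ys)) (a y * f (x ∷ ys)) _ ⟩
    a y * f (x ∷ ys) + (a x * f (y ∷ ys) + S a (λ r → f (y ∷ x ∷ r)) ys) ∎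
    where
    open ≡-Reasoning
    l : ∀ x y z → x + (y + z) ≡ y + (x + z)
    l = solve-∀
  S-↭ a ff (transᵖ p q) = trans (S-↭ a ff p) (S-↭ a ff q)

  S-zero : ∀ {P : V → Set} {a f vs} → All P vs → (∀ {u} → P u → a u ≡ 0) → S a f vs ≡ 0
  S-zero []           h = refl
  S-zero (p ∷ ps)     h rewrite h p = S-zero ps h

  S-length : ∀ vs → S (λ _ → 1) (λ _ → 1) vs ≡ length vs
  S-length []       = refl
  S-length (v ∷ vs) = cong suc (S-length vs)

  -- For constant f this compares products of set sizes with equal sums, union and intersection
  -- being the more unequal pair. Weights are handled by induction on the list: an entry in only one
  -- set is paired with the intersection on the left and with a larger set on the right, and an
  -- entry in both sees only the sum of the two sets, which is the same on either side.
  S-compress : ∀ (p q : V → Bool) f vs →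
    S (λ u → ⟦ p u ∨ q u ⟧) (S (λ u → ⟦ p u ∧ q u ⟧) f) vs ≤ S (λ u → ⟦ p u ⟧) (S (λ u → ⟦ q u ⟧) f) vs
  S-compress p q f []       = z≤n
  S-compress p q f (u ∷ us) = begin
    S a′ (S b′ f) (u ∷ us)
      ≡⟨ S-cons a′ b′ f u us ⟩
    a′ u * S b′ f us + b′ u * S a′ f us + S a′ (S b′ (f ∘ (u ∷_))) us
      ≤⟨ +-mono-≤ (head (p u) (q u)) (S-compress p q (f ∘ (u ∷_)) us) ⟩
    a u * S b f us + b u * S a f us + S a (S b (f ∘ (u ∷_))) us
      ≡⟨ sym (S-cons a b f u us) ⟩
    S a (S b f) (u ∷ us) ∎
    where
    open ≤-Reasoning
    a b a′ b′ : V → ℕ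
    a  v = ⟦ p v ⟧
    b  v = ⟦ q v ⟧
    a′ v = ⟦ p v ∨ q v ⟧
    b′ v = ⟦ p v ∧ q v ⟧
    b′≤a : ∀ x y → ⟦ x ∧ y ⟧ ≤ ⟦ x ⟧
    b′≤a false y = z≤n
    b′≤a true  y = ⟦⟧≤1 y
    b′≤b : ∀ x y → ⟦ x ∧ y ⟧ ≤ ⟦ y ⟧
    b′≤b false y = z≤n
    b′≤b true  y = ≤-refl
    sum≡ : ∀ x y → ⟦ x ∧ y ⟧ + ⟦ x ∨ y ⟧ ≡ ⟦ y ⟧ + ⟦ x ⟧
    sum≡ false y     = +-comm 0 _
    sum≡ true  false = refl
    sum≡ true  true  = refl
    head : ∀ x y → ⟦ x ∨ y ⟧ * S b′ f us + ⟦ x ∧ y ⟧ * S a′ f us ≤ ⟦ x ⟧ * S b f us + ⟦ y ⟧ * S a f us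
    head false false = z≤n
    head false true  = ≤-trans (≤-reflexive (+-identityʳ _))
      (+-monoˡ-≤ 0 (S-mono f (λ v → b′≤a (p v) (q v)) us))
    head true  false = +-monoˡ-≤ 0 (+-monoˡ-≤ 0 (S-mono f (λ v → b′≤b (p v) (q v)) us))
    head true  true  = ≤-reflexive (trans (l (S b′ f us) (S a′ f us)) (trans (sym (S-+ˡ b′ a′ f us))
      (trans (S-congˡ (λ v → sum≡ (p v) (q v)) us) (trans (S-+ˡ b a f us) (sym (l (S b f us) (S a f us)))))))
      where
      l : ∀ x y → 1 * x + 1 * y ≡ x + y
      l = solve-∀

  Symmetricᵇ : (V → V → Bool) → Set
  Symmetricᵇ R = ∀ u v → R u v ≡ R v u

  -- M R k vs is the number of k-matchings of the graph with vertices vs and adjacency R.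
  M : (V → V → Bool) → ℕ → List V → ℕ
  M R zero    vs       = 1
  M R (suc k) []       = 0
  M R (suc k) (v ∷ vs) = M R (suc k) vs + S (λ u → ⟦ R v u ⟧) (M R k) vs

  M-cong : ∀ {P : V → Set} {R R′} → (∀ {u v} → P u → P v → R u v ≡ R′ u v) →
    ∀ k {vs} → All P vs → M R k vs ≡ M R′ k vs
  M-cong h zero    ps       = refl
  M-cong h (suc k) []       = refl
  M-cong h (suc k) (p ∷ ps) = cong₂ _+_ (M-cong h (suc k) ps) (S-cong ps (cong ⟦_⟧ ∘ h p) (M-cong h k))

  -- The summands, in order: neither w nor x covered, x alone, the edge wx used, w alone, both
  -- covered by different edges.
  M-two : ∀ R k w x vs → M R (suc (suc k)) (w ∷ x ∷ vs) ≡
    M R (suc (suc k)) vs + S (λ u → ⟦ R x u ⟧) (M R (suc k)) vs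
      + (⟦ R w x ⟧ * M R (suc k) vs
        + (S (λ u → ⟦ R w u ⟧) (M R (suc k)) vs + S (λ u → ⟦ R w u ⟧) (S (λ u → ⟦ R x u ⟧) (M R k)) vs))
  M-two R k w x vs = cong (λ s → M R (suc (suc k)) (x ∷ vs) + (⟦ R w x ⟧ * M R (suc k) vs + s))
    (S-+ʳ (λ u → ⟦ R w u ⟧) (M R (suc k)) (S (λ u → ⟦ R x u ⟧) (M R k)) vs)

  -- Only the swap of two vertices has content: if both are covered by different edges, their
  -- partners may be chosen in either order, by `S-comm`.
  M-↭ : ∀ {R} → Symmetricᵇ R → ∀ k {us vs} → us ↭ vs → M R k us ≡ M R k vs
  M-↭ {R} sy zero    p             = refl
  M-↭ {R} sy (suc k) refl          = refl
  M-↭ {R} sy (suc k) (prep x p)    = cong₂ _+_ (M-↭ sy (suc k) p) (S-↭ (λ u → ⟦ R x u ⟧) (M-↭ sy k) p)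
  M-↭ {R} sy (suc k) (transᵖ p q)   = trans (M-↭ sy (suc k) p) (M-↭ sy (suc k) q)
  M-↭ {R} sy (suc zero) (swap {xs} {ys} x y p) = begin
    M R 1 xs + B xs + (⟦ R x y ⟧ * 1 + A xs)
      ≡⟨ cong₂ _+_ (cong₂ _+_ (M-↭ sy 1 p) (S-↭ _ (λ _ → refl) p))
                   (cong₂ (λ b s → ⟦ b ⟧ * 1 + s) (sy x y) (S-↭ _ (λ _ → refl) p)) ⟩
    M R 1 ys + B ys + (⟦ R y x ⟧ * 1 + A ys)
      ≡⟨ l (M R 1 ys) (B ys) (⟦ R y x ⟧ * 1) (A ys) ⟩
    M R 1 ys + A ys + (⟦ R y x ⟧ * 1 + B ys) ∎
    where
    open ≡-Reasoning
    A B : List V → ℕ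
    A = S (λ u → ⟦ R x u ⟧) (λ _ → 1)
    B = S (λ u → ⟦ R y u ⟧) (λ _ → 1)
    l : ∀ x b c a → x + b + (c + a) ≡ x + a + (c + b)
    l = solve-∀
  M-↭ {R} sy (suc (suc k)) (swap {xs} {ys} x y p) = begin
    M R (suc (suc k)) (x ∷ y ∷ xs)
      ≡⟨ M-two R k x y xs ⟩
    M R (suc (suc k)) xs + S b f xs + (⟦ R x y ⟧ * f xs + (S a f xs + S a (S b (M R k)) xs))
      ≡⟨ cong₂ _+_ (cong₂ _+_ (M-↭ sy (suc (suc k)) p) (S-↭ b (M-↭ sy (suc k)) p))
           (cong₂ _+_ (cong₂ (λ c s → ⟦ c ⟧ * s) (sy x y) (M-↭ sy (suc k) p))
             (cong₂ _+_ (S-↭ a (M-↭ sy (suc k)) p)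
               (trans (S-↭ a (S-↭ b (M-↭ sy k)) p) (S-comm a b (M R k) ys)))) ⟩
    M R (suc (suc k)) ys + S b f ys + (⟦ R y x ⟧ * f ys + (S a f ys + S b (S a (M R k)) ys))
      ≡⟨ l (M R (suc (suc k)) ys) (S b f ys) (⟦ R y x ⟧ * f ys) (S a f ys) _ ⟩
    M R (suc (suc k)) ys + S a f ys + (⟦ R y x ⟧ * f ys + (S b f ys + S b (S a (M R k)) ys))
      ≡⟨ sym (M-two R k y x ys) ⟩
    M R (suc (suc k)) (y ∷ x ∷ ys) ∎
    where
    open ≡-Reasoning
    a b : V → ℕ
    a u = ⟦ R x u ⟧
    b u = ⟦ R y u ⟧
    f : List V → ℕ
    f = M R (suc k)
    l : ∀ x b c a d → x + b + (c + (a + d)) ≡ x + a + (c + (b + d))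
    l = solve-∀

  M₁≤tri : ∀ R vs → M R 1 vs ≤ tri (length vs)
  M₁≤tri R []       = z≤n
  M₁≤tri R (v ∷ vs) = ≤-trans (+-mono-≤ (M₁≤tri R vs)
      (≤-trans (S-mono (λ _ → 1) (λ u → ⟦⟧≤1 (R v u)) vs) (≤-reflexive (S-length vs))))
    (≤-reflexive (+-comm (tri (length vs)) (length vs)))

  -- The double count of `W-delete` for an arbitrary graph: pairs of a k-matching and an uncovered
  -- vertex.
  M-delete : ∀ R k vs → S (λ _ → 1) (M R k) vs + 2 * k * M R k vs ≡ length vs * M R k vs
  M-delete R zero    vs = trans (+-identityʳ _) (trans (S-length vs) (sym (*-identityʳ _)))
  M-delete R (suc k) [] = *-zeroʳ (2 * suc k)
  M-delete R (suc k) (v ∷ vs) = begin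
    1 * μ + S one (λ r → M R (suc k) r + S b (M R k) r) vs + 2 * suc k * (μ + s)
      ≡⟨ cong (λ x → 1 * μ + x + 2 * suc k * (μ + s)) (S-+ʳ one (M R (suc k)) (S b (M R k)) vs) ⟩
    1 * μ + (S one (M R (suc k)) vs + S one (S b (M R k)) vs) + 2 * suc k * (μ + s)
      ≡⟨ cong (λ x → 1 * μ + (S one (M R (suc k)) vs + x) + 2 * suc k * (μ + s)) (S-comm one b (M R k) vs) ⟩
    1 * μ + (S one (M R (suc k)) vs + S b (S one (M R k)) vs) + 2 * suc k * (μ + s)
      ≡⟨ l₁ μ (S one (M R (suc k)) vs) (S b (S one (M R k)) vs) k s ⟩
    μ + (S one (M R (suc k)) vs + 2 * suc k * μ) + (S b (S one (M R k)) vs + 2 * k * s + s) + s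
      ≡⟨ cong₂ (λ x y → μ + x + y + s) (M-delete R (suc k) vs) inner ⟩
    μ + length vs * μ + length vs * s + s
      ≡⟨ l₂ μ (length vs) s ⟩
    suc (length vs) * (μ + s) ∎
    where
    open ≡-Reasoning
    one b : V → ℕ
    one _ = 1
    b u = ⟦ R v u ⟧
    μ s : ℕ
    μ = M R (suc k) vs
    s = S b (M R k) vs
    l₁ : ∀ μ x y k s → 1 * μ + (x + y) + 2 * suc k * (μ + s) ≡ μ + (x + 2 * suc k * μ) + (y + 2 * k * s + s) + s
    l₁ = solve-∀
    l₂ : ∀ μ n s → μ + n * μ + n * s + s ≡ suc n * (μ + s)
    l₂ = solve-∀
    S-len : ∀ f vs → S b (λ r → length r * f r) vs + S b f vs ≡ length vs * S b f vs
    S-len f []       = refl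
    S-len f (u ∷ us) = begin
      b u * (length us * f us) + S b (λ r → suc (length r) * f (u ∷ r)) us + (b u * f us + S b g us)
        ≡⟨ cong (λ x → b u * (length us * f us) + x + (b u * f us + S b g us)) (S-+ʳ b g (λ r → length r * g r) us) ⟩
      b u * (length us * f us) + (S b g us + S b (λ r → length r * g r) us) + (b u * f us + S b g us)
        ≡⟨ l₃ (b u) (length us) (f us) (S b g us) (S b (λ r → length r * g r) us) ⟩
      b u * (length us * f us) + (b u * f us + S b g us) + (S b (λ r → length r * g r) us + S b g us)
        ≡⟨ cong (λ x → b u * (length us * f us) + (b u * f us + S b g us) + x) (S-len g us) ⟩
      b u * (length us * f us) + (b u * f us + S b g us) + length us * S b g us
        ≡⟨ l₄ (b u) (length us) (f us) (S b g us) ⟩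
      suc (length us) * (b u * f us + S b g us) ∎
      where
      g : List V → ℕ
      g = f ∘ (u ∷_)
      l₃ : ∀ b n f x y → b * (n * f) + (x + y) + (b * f + x) ≡ b * (n * f) + (b * f + x) + (y + x)
      l₃ = solve-∀
      l₄ : ∀ b n f x → b * (n * f) + (b * f + x) + n * x ≡ suc n * (b * f + x)
      l₄ = solve-∀
    inner : S b (S one (M R k)) vs + 2 * k * s + s ≡ length vs * s
    inner = begin
      S b (S one (M R k)) vs + 2 * k * s + s
        ≡⟨ cong (λ x → S b (S one (M R k)) vs + x + s) (sym (S-*ʳ b (2 * k) (M R k) vs)) ⟩
      S b (S one (M R k)) vs + S b (λ r → 2 * k * M R k r) vs + s
        ≡⟨ cong (_+ s) (sym (S-+ʳ b (S one (M R k)) (λ r → 2 * k * M R k r) vs)) ⟩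
      S b (λ r → S one (M R k) r + 2 * k * M R k r) vs + s
        ≡⟨ cong (_+ s) (S-congʳ (M-delete R k) vs) ⟩
      S b (λ r → length r * M R k r) vs + s
        ≡⟨ S-len (M R k) vs ⟩
      length vs * s ∎

  M-dominator : ∀ R w {us} → All (λ u → R w u ≡ true) us →
    (λ k → M R k (w ∷ us)) ≗ D (length us) (λ k → M R k us)
  M-dominator R w          dom zero    = refl
  M-dominator R w {us} dom (suc k) = cong (M R (suc k) us +_) (begin
    S (λ u → ⟦ R w u ⟧) (M R k) us
      ≡⟨ S-cong dom (cong ⟦_⟧) (λ _ → refl) ⟩
    S (λ _ → 1) (M R k) us
      ≡⟨ sym (m+n∸n≡m _ (2 * k * M R k us)) ⟩
    S (λ _ → 1) (M R k) us + 2 * k * M R k us ∸ 2 * k * M R k us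
      ≡⟨ cong (_∸ 2 * k * M R k us) (M-delete R k us) ⟩
    length us * M R k us ∸ 2 * k * M R k us
      ≡⟨ sym (*-distribʳ-∸ (M R k us) (length us) (2 * k)) ⟩
    (length us ∸ 2 * k) * M R k us ∎)
    where open ≡-Reasoning

  M-isolated : ∀ R y {us} → All (λ u → R y u ≡ false) us → ∀ k → M R k (y ∷ us) ≡ M R k us
  M-isolated R y iso zero    = refl
  M-isolated R y iso (suc k) = trans (cong (_ +_) (S-zero iso (cong ⟦_⟧))) (+-identityʳ _)

  Unique-↭ : ∀ {us vs : List V} → us ↭ vs → Unique us → Unique vs
  Unique-↭ refl         un = un
  Unique-↭ (prep x p)   (x∉ ∷ un) = All-resp-↭ p x∉ ∷ Unique-↭ p un
  Unique-↭ (swap x y p) ((x≢y ∷ x∉) ∷ y∉ ∷ un) =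
    ((x≢y ∘ sym) ∷ All-resp-↭ p y∉) ∷ All-resp-↭ p x∉ ∷ Unique-↭ p un
  Unique-↭ (transᵖ p q)  un = Unique-↭ q (Unique-↭ p un)

  allOrSplit : ∀ (f : V → Bool) b us →
    All (λ u → f u ≡ b) us ⊎ ∃₂ λ y rest → us ↭ y ∷ rest × f y ≡ not b
  allOrSplit f b [] = inj₁ []
  allOrSplit f b (u ∷ us) with f u in eq | b
  ... | false | true  = inj₂ (u , us , ↭-refl , eq)
  ... | true  | false = inj₂ (u , us , ↭-refl , eq)
  ... | false | false with allOrSplit f false us
  ...   | inj₁ all = inj₁ (eq ∷ all)
  ...   | inj₂ (y , r , p , fy) = inj₂ (y , u ∷ r , ↭-trans (↭-prep u p) (↭-swap u y ↭-refl) , fy)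
  allOrSplit f b (u ∷ us) | true | true with allOrSplit f true us
  ...   | inj₁ all = inj₁ (eq ∷ all)
  ...   | inj₂ (y , r , p , fy) = inj₂ (y , u ∷ r , ↭-trans (↭-prep u p) (↭-swap u y ↭-refl) , fy)

-- Compression and the induction on the number of vertices

data Extremal (p : ℕ → ℕ) (n : ℕ) : Set where
  aboveLex : p ⊵ lex n (p 1) → Extremal p n
  aboveCol : p ⊵ col n (p 1) → Extremal p n

extremal-⊵ : ∀ {p p′ n} → p ⊵ p′ → p 1 ≡ p′ 1 → Extremal p′ n → Extremal p n
extremal-⊵ {p} {n = n} p⊵ eq (aboveLex h) = aboveLex (⊵-trans p⊵ (subst (λ e → _ ⊵ lex n e) (sym eq) h))
extremal-⊵ {p} {n = n} p⊵ eq (aboveCol h) = aboveCol (⊵-trans p⊵ (subst (λ e → _ ⊵ col n e) (sym eq) h))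

extremal-addIsolated : ∀ {p n} → p 1 ≤ tri n → Extremal p n → Extremal p (suc n)
extremal-addIsolated {p} {n} e≤ (aboveLex h) with lex-addIsolated n (p 1) e≤
... | inj₁ l = aboveLex (⊵-trans h l)
... | inj₂ c = aboveCol (⊵-trans h c)
extremal-addIsolated {p} {n} e≤ (aboveCol h) = aboveCol (subst (p ⊵_) (sym (col-addIsolated e≤)) h)

extremal-addDominator : ∀ {p n} → p 0 ≡ 1 → p 1 ≤ tri n → Extremal p n → Extremal (D n p) (suc n)
extremal-addDominator {p} {n} p₀ e≤ = go
  where
  e≡ : n + p 1 ≡ D n p 1
  e≡ = trans (+-comm n (p 1)) (cong (p 1 +_) (sym (trans (cong (n *_) p₀) (*-identityʳ n))))
  above : D n p ⊵ lex (suc n) (n + p 1) ⊎ D n p ⊵ col (suc n) (n + p 1) → Extremal (D n p) (suc n)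
  above (inj₁ l) = aboveLex (subst (λ e → D n p ⊵ lex (suc n) e) e≡ l)
  above (inj₂ c) = aboveCol (subst (λ e → D n p ⊵ col (suc n) e) e≡ c)
  go : Extremal p n → Extremal (D n p) (suc n)
  go (aboveLex h) = above (inj₁ (⊵-trans (D-mono n h) (≗⇒⊵ λ k → sym (lex-dominator n (p 1) k))))
  go (aboveCol h) with col-addDominator n (p 1) e≤
  ... | inj₁ l = above (inj₁ (⊵-trans (D-mono n h) l))
  ... | inj₂ c = above (inj₂ (⊵-trans (D-mono n h) c))

module _ {V : Set} (_≟_ : DecidableEquality V) where

  -- The Kelmans transformation from x to w. The tests on u and v treat both orders of a pair, so
  -- that the relation stays symmetric.
  compress : (V → V → Bool) → V → V → V → V → Bool
  compress R w x u v with u ≟ w | u ≟ x | v ≟ w | v ≟ x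
  ... | yes _ | _     | _     | yes _ = R w x
  ... | yes _ | _     | _     | no  _ = R w v ∨ R x v
  ... | no  _ | yes _ | yes _ | _     = R w x
  ... | no  _ | yes _ | no  _ | _     = R w v ∧ R x v
  ... | no  _ | no  _ | yes _ | _     = R w u ∨ R x u
  ... | no  _ | no  _ | no  _ | yes _ = R w u ∧ R x u
  ... | no  _ | no  _ | no  _ | no  _ = R u v

  compress-sym : ∀ {R} w x → w ≢ x → Symmetricᵇ R → Symmetricᵇ (compress R w x)
  compress-sym w x w≢x sy u v with u ≟ w | u ≟ x | v ≟ w | v ≟ x
  ... | yes refl | yes refl | _          | _          = contradiction refl w≢x
  ... | yes refl | no  _      | yes refl | yes refl = contradiction refl w≢x
  ... | yes refl | no  _      | yes refl | no  _      = refl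
  ... | yes refl | no  _      | no  _      | yes refl = refl
  ... | yes refl | no  _      | no  _      | no  _      = refl
  ... | no  _      | yes refl | yes refl | yes refl = contradiction refl w≢x
  ... | no  _      | yes refl | yes refl | no  _      = refl
  ... | no  _      | yes refl | no  _      | yes refl = refl
  ... | no  _      | yes refl | no  _      | no  _      = refl
  ... | no  _      | no  _      | yes refl | yes refl = contradiction refl w≢x
  ... | no  _      | no  _      | yes refl | no  _      = refl
  ... | no  _      | no  _      | no  _      | yes refl = refl
  ... | no  _      | no  _      | no  _      | no  _      = sy u v

  module Compression (R : V → V → Bool) (w x : V) (w≢x : w ≢ x) where

    R′ : V → V → Bool
    R′ = compress R w x

    Other : V → Set
    Other u = w ≢ u × x ≢ u

    R′-wx : R′ w x ≡ R w x
    R′-wx with w ≟ w | w ≟ x | x ≟ w | x ≟ x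
    ... | yes _ | _ | _ | yes _  = refl
    ... | yes _ | _ | _ | no x≢x = contradiction refl x≢x
    ... | no w≢w | _ | _ | _     = contradiction refl w≢w

    R′-w : ∀ {v} → Other v → R′ w v ≡ R w v ∨ R x v
    R′-w {v} (w≢v , x≢v) with w ≟ w | w ≟ x | v ≟ w | v ≟ x
    ... | no w≢w | _ | _ | _       = contradiction refl w≢w
    ... | yes _  | _ | _ | yes v≡x = contradiction (sym v≡x) x≢v
    ... | yes _  | _ | _ | no _    = refl

    R′-x : ∀ {v} → Other v → R′ x v ≡ R w v ∧ R x v
    R′-x {v} (w≢v , x≢v) with x ≟ w | x ≟ x | v ≟ w | v ≟ x
    ... | yes x≡w | _       | _       | _ = contradiction (sym x≡w) w≢x
    ... | no _    | no x≢x  | _       | _ = contradiction refl x≢x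
    ... | no _    | yes _   | yes v≡w | _ = contradiction (sym v≡w) w≢v
    ... | no _    | yes _   | no _    | _ = refl

    R′-other : ∀ {u v} → Other u → Other v → R′ u v ≡ R u v
    R′-other {u} {v} (w≢u , x≢u) (w≢v , x≢v) with u ≟ w | u ≟ x | v ≟ w | v ≟ x
    ... | yes u≡w | _       | _       | _       = contradiction (sym u≡w) w≢u
    ... | no _    | yes u≡x | _       | _       = contradiction (sym u≡x) x≢u
    ... | no _    | no _    | yes v≡w | _       = contradiction (sym v≡w) w≢v
    ... | no _    | no _    | no _    | yes v≡x = contradiction (sym v≡x) x≢v
    ... | no _    | no _    | no _    | no _    = refl

    module _ {vs : List V} (others : All Other vs) where

      a b a′ b′ : V → ℕ
      a  u = ⟦ R w u ⟧
      b  u = ⟦ R x u ⟧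
      a′ u = ⟦ R w u ∨ R x u ⟧
      b′ u = ⟦ R w u ∧ R x u ⟧

      degreeSum : ∀ f → S b f vs + S a f vs ≡ S b′ f vs + S a′ f vs
      degreeSum f = trans (sym (S-+ˡ b a f vs))
        (trans (S-congˡ (λ u → lem (R w u) (R x u)) vs) (S-+ˡ b′ a′ f vs))
        where
        lem : ∀ p q → ⟦ q ⟧ + ⟦ p ⟧ ≡ ⟦ p ∧ q ⟧ + ⟦ p ∨ q ⟧
        lem false q     = +-identityʳ _
        lem true  false = refl
        lem true  true  = refl

      S-w : ∀ {f g} → (∀ {r} → All Other r → f r ≡ g r) → S (λ u → ⟦ R′ w u ⟧) f vs ≡ S a′ g vs
      S-w fg = S-cong others (cong ⟦_⟧ ∘ R′-w) fg

      S-x : ∀ {f g us} → All Other us → (∀ {r} → All Other r → f r ≡ g r) → S (λ u → ⟦ R′ x u ⟧) f us ≡ S b′ g us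
      S-x os fg = S-cong os (cong ⟦_⟧ ∘ R′-x) fg

      M-other : ∀ k {us} → All Other us → M R′ k us ≡ M R k us
      M-other = M-cong R′-other

      M-compress₁ : M R 1 (w ∷ x ∷ vs) ≡ M R′ 1 (w ∷ x ∷ vs)
      M-compress₁ = begin
        M R 1 vs + S b one vs + (⟦ R w x ⟧ * 1 + S a one vs)
          ≡⟨ l (M R 1 vs) (S b one vs) (⟦ R w x ⟧ * 1) (S a one vs) ⟩
        M R 1 vs + ⟦ R w x ⟧ * 1 + (S b one vs + S a one vs)
          ≡⟨ cong (M R 1 vs + ⟦ R w x ⟧ * 1 +_) (degreeSum one) ⟩
        M R 1 vs + ⟦ R w x ⟧ * 1 + (S b′ one vs + S a′ one vs)
          ≡⟨ sym (l (M R 1 vs) (S b′ one vs) (⟦ R w x ⟧ * 1) (S a′ one vs)) ⟩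
        M R 1 vs + S b′ one vs + (⟦ R w x ⟧ * 1 + S a′ one vs)
          ≡⟨ sym (cong₂ _+_ (cong₂ _+_ (M-other 1 others) (S-x others (λ _ → refl)))
                (cong₂ (λ c s → ⟦ c ⟧ * 1 + s) R′-wx (S-w (λ _ → refl)))) ⟩
        M R′ 1 (w ∷ x ∷ vs) ∎
        where
        open ≡-Reasoning
        one : List V → ℕ
        one _ = 1
        l : ∀ m b c a → m + b + (c + a) ≡ m + c + (b + a)
        l = solve-∀

      -- In `M-two`, the matchings covering exactly one of w and x depend only on the two
      -- neighbourhoods counted with multiplicity, which compression preserves (`degreeSum`). Only
      -- the matchings covering both by different edges change, and `S-compress` bounds those.
      M-compress : (λ k → M R k (w ∷ x ∷ vs)) ⊵ (λ k → M R′ k (w ∷ x ∷ vs))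
      M-compress zero          = ≤-refl
      M-compress (suc zero)    = ≤-reflexive (sym M-compress₁)
      M-compress (suc (suc k)) = begin
        M R′ (suc (suc k)) (w ∷ x ∷ vs)
          ≡⟨ M-two R′ k w x vs ⟩
        M R′ (suc (suc k)) vs + S (λ u → ⟦ R′ x u ⟧) (M R′ (suc k)) vs
          + (⟦ R′ w x ⟧ * M R′ (suc k) vs + (S (λ u → ⟦ R′ w u ⟧) (M R′ (suc k)) vs
            + S (λ u → ⟦ R′ w u ⟧) (S (λ u → ⟦ R′ x u ⟧) (M R′ k)) vs))
          ≡⟨ cong₂ _+_ (cong₂ _+_ (M-other (suc (suc k)) others) (S-x others (M-other (suc k))))
               (cong₂ _+_ (cong₂ (λ c s → ⟦ c ⟧ * s) R′-wx (M-other (suc k) others))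
                 (cong₂ _+_ (S-w (M-other (suc k))) (S-w (λ os → S-x os (M-other k))))) ⟩
        μ + S b′ f vs + (c + (S a′ f vs + S a′ (S b′ (M R k)) vs))
          ≡⟨ l μ (S b′ f vs) c (S a′ f vs) (S a′ (S b′ (M R k)) vs) ⟩
        μ + c + (S b′ f vs + S a′ f vs) + S a′ (S b′ (M R k)) vs
          ≤⟨ +-mono-≤ (≤-reflexive (cong (μ + c +_) (sym (degreeSum f)))) (S-compress (R w) (R x) (M R k) vs) ⟩
        μ + c + (S b f vs + S a f vs) + S a (S b (M R k)) vs
          ≡⟨ sym (l μ (S b f vs) c (S a f vs) (S a (S b (M R k)) vs)) ⟩
        μ + S b f vs + (c + (S a f vs + S a (S b (M R k)) vs))
          ≡⟨ sym (M-two R k w x vs) ⟩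
        M R (suc (suc k)) (w ∷ x ∷ vs) ∎
        where
        open ≤-Reasoning
        f : List V → ℕ
        f = M R (suc k)
        μ c : ℕ
        μ = M R (suc (suc k)) vs
        c = ⟦ R w x ⟧ * M R (suc k) vs
        l : ∀ μ b c a d → μ + b + (c + (a + d)) ≡ μ + c + (b + a) + d
        l = solve-∀

  nonNeighbours : (V → V → Bool) → V → List V → ℕ
  nonNeighbours R w = S (λ u → ⟦ not (R w u) ⟧) (λ _ → 1)

  -- The termination measure of the repeated compression: w gains the private neighbour y of x and
  -- loses no neighbour.
  nonNeighbours-compress : ∀ R w x y vs (w≢x : w ≢ x) → All (Compression.Other R w x w≢x) (y ∷ vs) →
    R w y ≡ false → R x y ≡ true →
    nonNeighbours (compress R w x) w (x ∷ y ∷ vs) < nonNeighbours R w (x ∷ y ∷ vs)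
  nonNeighbours-compress R w x y vs w≢x (oy ∷ os) Rwy Rxy
    rewrite Compression.R′-wx R w x w≢x | Compression.R′-w R w x w≢x oy | Rwy | Rxy =
    +-monoʳ-< (⟦ not (R w x) ⟧ * 1) (s≤s (≤-trans
      (≤-reflexive (S-cong os (cong (⟦_⟧ ∘ not) ∘ Compression.R′-w R w x w≢x) (λ _ → refl)))
      (S-mono (λ _ → 1) (λ u → lem (R w u) (R x u)) vs)))
    where
    lem : ∀ p q → ⟦ not (p ∨ q) ⟧ ≤ ⟦ not p ⟧
    lem false q = ⟦⟧≤1 (not q)
    lem true  q = z≤n

  Claim : ℕ → Set
  Claim n = ∀ (R : V → V → Bool) → Symmetricᵇ R → ∀ vs → Unique vs → length vs ≡ n → Extremal (λ k → M R k vs) n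

  extremal-↭ : ∀ {R : V → V → Bool} {n} → Symmetricᵇ R → ∀ {us vs} → us ↭ vs →
    Extremal (λ k → M R k vs) n → Extremal (λ k → M R k us) n
  extremal-↭ sy p = extremal-⊵ (≗⇒⊵ λ k → M-↭ sy k p) (M-↭ sy 1 p)

  -- Compress into w until w dominates or some vertex is isolated.
  extremal-step : ∀ n → Claim n → ∀ fuel R → Symmetricᵇ R → ∀ w us → Unique (w ∷ us) → length us ≡ n →
    nonNeighbours R w us ≤ fuel → Extremal (λ k → M R k (w ∷ us)) (suc n)
  extremal-step n ih fuel R sy w us un@(_ ∷ un-us) refl nn≤ with allOrSplit (R w) true us
  ... | inj₁ dom = extremal-⊵ (≗⇒⊵ (M-dominator R w dom)) (M-dominator R w dom 1)
    (extremal-addDominator refl (M₁≤tri R us) (ih R sy us un-us refl))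
  ... | inj₂ (y , rest , us↭ , Rwy) with allOrSplit (R y) false rest
  ...   | inj₁ iso = extremal-↭ sy p (extremal-⊵ (≗⇒⊵ (M-isolated R y iso′)) (M-isolated R y iso′ 1)
    (extremal-addIsolated e≤ (ih R sy (w ∷ rest) (un′ (Unique-↭ p un)) len)))
    where
    p : w ∷ us ↭ y ∷ w ∷ rest
    p = ↭-trans (↭-prep w us↭) (↭-swap w y ↭-refl)
    iso′ : All (λ u → R y u ≡ false) (w ∷ rest)
    iso′ = trans (sy y w) Rwy ∷ iso
    len : suc (length rest) ≡ length us
    len = sym (↭-length us↭)
    e≤ : M R 1 (w ∷ rest) ≤ tri (length us)
    e≤ = subst (λ m → M R 1 (w ∷ rest) ≤ tri m) len (M₁≤tri R (w ∷ rest))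
    un′ : Unique (y ∷ w ∷ rest) → Unique (w ∷ rest)
    un′ (_ ∷ u) = u
  -- The non-neighbour y of w is not isolated, so it has a neighbour x, and compressing x into w
  -- makes w adjacent to y.
  ...   | inj₂ (x , rest′ , rest↭ , Ryx) = compressed fuel nn≤ (Unique-↭ (↭-prep w p) un)
    where
    p : us ↭ x ∷ y ∷ rest′
    p = ↭-trans us↭ (↭-trans (↭-prep y rest↭) (↭-swap y x ↭-refl))
    compressed : ∀ fuel → nonNeighbours R w us ≤ fuel → Unique (w ∷ x ∷ y ∷ rest′) →
      Extremal (λ k → M R k (w ∷ us)) (suc (length us))
    compressed fuel nn≤ un@((w≢x ∷ w∉) ∷ x∉ ∷ _) with ≤-trans
      (nonNeighbours-compress R w x y rest′ w≢x (All.zip (w∉ , x∉)) Rwy (trans (sy x y) Ryx))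
      (≤-trans (≤-reflexive (sym (S-↭ _ (λ _ → refl) p))) nn≤)
    ... | lt = extremal-↭ sy (↭-prep w p) (extremal-⊵ (M-compress others) (M-compress₁ others) (rec fuel lt))
      where
      open Compression R w x w≢x
      others : All Other (y ∷ rest′)
      others = All.zip (w∉ , x∉)
      rec : ∀ fuel → nonNeighbours R′ w (x ∷ y ∷ rest′) < fuel → Extremal (λ k → M R′ k (w ∷ x ∷ y ∷ rest′)) (suc (length us))
      rec (suc fuel) (s≤s nn≤) = extremal-step n ih fuel R′ (compress-sym w x w≢x sy) w (x ∷ y ∷ rest′) un (sym (↭-length p)) nn≤

  extremal : ∀ n → Claim n
  extremal zero    R sy []       un len = aboveLex λ { zero → ≤-refl ; (suc zero) → z≤n ; (suc (suc k)) → z≤n }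
  extremal (suc n) R sy (w ∷ us) un len =
    extremal-step n (extremal n) _ R sy w us un (suc-injective len) ≤-refl

-- From sets of edges to lists of vertices

cnt : {A : Set} → (A → Bool) → List A → ℕ
cnt p []       = 0
cnt p (x ∷ xs) = ⟦ p x ⟧ + cnt p xs

module _ {A : Set} where

  cnt-cong : ∀ {p q : A → Bool} → p ≗ q → ∀ xs → cnt p xs ≡ cnt q xs
  cnt-cong pq []       = refl
  cnt-cong pq (x ∷ xs) = cong₂ _+_ (cong ⟦_⟧ (pq x)) (cnt-cong pq xs)

  cnt-++ : ∀ (p : A → Bool) xs ys → cnt p (xs ++ ys) ≡ cnt p xs + cnt p ys
  cnt-++ p []       ys = refl
  cnt-++ p (x ∷ xs) ys = trans (cong (⟦ p x ⟧ +_) (cnt-++ p xs ys)) (sym (+-assoc ⟦ p x ⟧ _ _))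

  cnt-map : ∀ {B : Set} (p : A → Bool) (f : B → A) xs → cnt p (map f xs) ≡ cnt (p ∘ f) xs
  cnt-map p f []       = refl
  cnt-map p f (x ∷ xs) = cong (⟦ p (f x) ⟧ +_) (cnt-map p f xs)

  cnt-false : ∀ (xs : List A) → cnt (λ _ → false) xs ≡ 0
  cnt-false []       = refl
  cnt-false (x ∷ xs) = cnt-false xs

  length-filterᵇ : ∀ (p : A → Bool) xs → length (filterᵇ p xs) ≡ cnt p xs
  length-filterᵇ p []       = refl
  length-filterᵇ p (x ∷ xs) with p x
  ... | true  = cong suc (length-filterᵇ p xs)
  ... | false = length-filterᵇ p xs

  cnt-filterᵇ : ∀ (p q : A → Bool) xs → cnt p (filterᵇ q xs) ≡ cnt (λ x → q x ∧ p x) xs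
  cnt-filterᵇ p q []       = refl
  cnt-filterᵇ p q (x ∷ xs) with q x
  ... | true  = cong (⟦ p x ⟧ +_) (cnt-filterᵇ p q xs)
  ... | false = cnt-filterᵇ p q xs

module _ {A : Set} where

  cnt-sublists-∷ : ∀ (p : List A → Bool) x xs →
    cnt p (sublists (x ∷ xs)) ≡ cnt p (sublists xs) + cnt (p ∘ (x ∷_)) (sublists xs)
  cnt-sublists-∷ p x xs = trans (cnt-++ p (sublists xs) _) (cong (cnt p (sublists xs) +_) (cnt-map p (x ∷_) (sublists xs)))

  cnt-sublists-all : ∀ (d : A → Bool) (p : List A → Bool) xs →
    cnt (λ s → all d s ∧ p s) (sublists xs) ≡ cnt p (sublists (filterᵇ d xs))
  cnt-sublists-all d p []       = refl
  cnt-sublists-all d p (x ∷ xs) with d x in eq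
  ... | true  = trans (cnt-sublists-∷ _ x xs) (trans (cong₂ _+_ (cnt-sublists-all d p xs)
    (trans (cnt-cong (λ s → cong (λ b → (b ∧ all d s) ∧ p (x ∷ s)) eq) (sublists xs))
      (cnt-sublists-all d (p ∘ (x ∷_)) xs))) (sym (cnt-sublists-∷ p x (filterᵇ d xs))))
  ... | false = trans (cnt-sublists-∷ _ x xs) (trans (cong₂ _+_ (cnt-sublists-all d p xs)
    (trans (cnt-cong (λ s → cong (λ b → (b ∧ all d s) ∧ p (x ∷ s)) eq) (sublists xs)) (cnt-false (sublists xs))))
      (+-identityʳ _))

  ∑ : (A → ℕ) → List A → ℕ
  ∑ g []       = 0
  ∑ g (x ∷ xs) = g x + ∑ g xs

  ∑-cong : ∀ {P : A → Set} {g h xs} → All P xs → (∀ {x} → P x → g x ≡ h x) → ∑ g xs ≡ ∑ h xs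
  ∑-cong []       gh = refl
  ∑-cong (p ∷ ps) gh = cong₂ _+_ (gh p) (∑-cong ps gh)

≡ᵇ-refl : ∀ i → (i ≡ᵇ i) ≡ true
≡ᵇ-refl zero    = refl
≡ᵇ-refl (suc i) = ≡ᵇ-refl i

≢⇒≡ᵇ : ∀ {i j} → i ≢ j → (i ≡ᵇ j) ≡ false
≢⇒≡ᵇ {i} {j} i≢j = ¬-not λ eq → i≢j (≡ᵇ⇒≡ i j (Equivalence.from T-≡ eq))

<⇒<ᵇ≡ : ∀ {i j} → i < j → (i <ᵇ j) ≡ true
<⇒<ᵇ≡ i<j = Equivalence.to T-≡ (<⇒<ᵇ i<j)

≥⇒<ᵇ≡ : ∀ {i j} → j ≤ i → (i <ᵇ j) ≡ false
≥⇒<ᵇ≡ {i} {j} j≤i = ¬-not λ eq → <⇒≱ (<ᵇ⇒< i j (Equivalence.from T-≡ eq)) j≤i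

<ᵇ-∸ : ∀ t e i → (t + i <ᵇ e) ≡ (i <ᵇ e ∸ t)
<ᵇ-∸ zero    e       i = refl
<ᵇ-∸ (suc t) zero    i = refl
<ᵇ-∸ (suc t) (suc e) i = <ᵇ-∸ t e i

concatMap-cong-local : ∀ {A B : Set} {f g : A → List B} {xs} → All (λ x → f x ≡ g x) xs →
  concatMap f xs ≡ concatMap g xs
concatMap-cong-local h = cong concat (map-cong-local h)

module _ {n : ℕ} where

  N : ℕ → List (Edge n) → ℕ
  N k es = cnt (λ s → isMatching s ∧ (length s ≡ᵇ k)) (sublists es)

  mₖ≡N : ∀ k (G : Graph n) → mₖ k G ≡ N k (edges G)
  mₖ≡N k G = trans (length-filterᵇ (λ s → length s ≡ᵇ k) (matchings G)) (cnt-filterᵇ _ isMatching (sublists (edges G)))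

  N-zero : ∀ es → N 0 es ≡ 1
  N-zero []       = refl
  N-zero (e ∷ es) = trans (cnt-sublists-∷ _ e es) (trans (cong₂ _+_ (N-zero es)
    (trans (cnt-cong (λ s → ∧-zeroʳ _) (sublists es)) (cnt-false (sublists es)))) refl)

  N-suc : ∀ k e es → N (suc k) (e ∷ es) ≡ N (suc k) es + N k (filterᵇ (disjointᵉ e) es)
  N-suc k e es = trans (cnt-sublists-∷ _ e es) (cong (N (suc k) es +_)
    (trans (cnt-cong (λ s → assoc (all (disjointᵉ e) s) (isMatching s) (length s ≡ᵇ k)) (sublists es))
      (cnt-sublists-all (disjointᵉ e) _ es)))
    where
    assoc : ∀ x y z → (x ∧ y) ∧ z ≡ x ∧ (y ∧ z)
    assoc false y z = refl
    assoc true  y z = refl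

  N-one : ∀ es → N 1 es ≡ length es
  N-one []       = refl
  N-one (e ∷ es) = trans (N-suc 0 e es) (trans (cong₂ _+_ (N-one es) (N-zero (filterᵇ (disjointᵉ e) es))) (+-comm _ 1))

  ≡ꟳ-≢ : ∀ {i j : Fin n} → i ≢ j → (i ≡ꟳ j) ≡ false
  ≡ꟳ-≢ i≢j = ≢⇒≡ᵇ (i≢j ∘ toℕ-injective)

  _∖_ : List (Fin n) → Fin n → List (Fin n)
  vs ∖ u = filterᵇ (λ t → not (u ≡ꟳ t)) vs

  ∖-absent : ∀ {u vs} → All (u ≢_) vs → vs ∖ u ≡ vs
  ∖-absent []              = refl
  ∖-absent (_∷_ {t} u≢t h) rewrite ≡ꟳ-≢ u≢t = cong (t ∷_) (∖-absent h)

  -- `S` removes an entry by position, while filtering edges removes a vertex by value; on a list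
  -- without repetitions these agree.
  S≡∑ : ∀ a f {vs} → Unique vs → S a f vs ≡ ∑ (λ u → a u * f (vs ∖ u)) vs
  S≡∑ a f []              = refl
  S≡∑ a f (_∷_ {u} {us} u∉ un) = cong₂ _+_ (cong (λ r → a u * f r) (sym eq))
    (trans (S≡∑ a (f ∘ (u ∷_)) un) (∑-cong u∉ keep))
    where
    eq : (u ∷ us) ∖ u ≡ us
    eq rewrite ≡ᵇ-refl (toℕ u) = ∖-absent u∉
    keep : ∀ {t} → u ≢ t → a t * f (u ∷ (us ∖ t)) ≡ a t * f ((u ∷ us) ∖ t)
    keep u≢t rewrite ≡ꟳ-≢ (u≢t ∘ sym) = refl

  edgesOn : Graph n → List (Fin n) → List (Edge n)
  edgesOn G []       = []
  edgesOn G (v ∷ vs) = map (v ,_) (filterᵇ (G v) vs) ++ edgesOn G vs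

  -- v does not occur in the row of c, so only u can meet its edges: the whole row goes if u = c,
  -- and otherwise just the edge to u.
  disjoint-row : ∀ (G : Graph n) {v} u {c ds} → v ≢ c → All (v ≢_) ds →
    filterᵇ (disjointᵉ (v , u)) (map (c ,_) (filterᵇ (G c) ds)) ≡
    (if u ≡ꟳ c then [] else map (c ,_) (filterᵇ (G c) (ds ∖ u)))
  disjoint-row G {v} u {c} v≢c [] with u ≡ꟳ c
  ... | true  = refl
  ... | false = refl
  disjoint-row G {v} u {c} {d ∷ ds} v≢c (v≢d ∷ h) with ih ← disjoint-row G u v≢c h | G c d in eq
  ... | true  rewrite ≡ꟳ-≢ v≢c | ≡ꟳ-≢ v≢d with u ≡ꟳ c | u ≡ꟳ d
  ...   | true  | _     = ih
  ...   | false | true  = ih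
  ...   | false | false rewrite eq = cong ((c , d) ∷_) ih
  disjoint-row G {v} u {c} {d ∷ ds} v≢c (v≢d ∷ h) | false with u ≡ꟳ c | u ≡ꟳ d
  ...   | true  | _     = ih
  ...   | false | true  = ih
  ...   | false | false rewrite eq = ih

  edgesOn-∖ : ∀ (G : Graph n) {v} u {vs} → All (v ≢_) vs →
    filterᵇ (disjointᵉ (v , u)) (edgesOn G vs) ≡ edgesOn G (vs ∖ u)
  edgesOn-∖ G u [] = refl
  edgesOn-∖ G u (_∷_ {c} {cs} v≢c h) = trans (filter-++ _ (map (c ,_) (filterᵇ (G c) cs)) (edgesOn G cs))
    (trans (cong₂ _++_ (disjoint-row G u v≢c h) (edgesOn-∖ G u h)) fin)
    where
    fin : (if u ≡ꟳ c then [] else map (c ,_) (filterᵇ (G c) (cs ∖ u))) ++ edgesOn G (cs ∖ u) ≡ edgesOn G ((c ∷ cs) ∖ u)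
    fin with u ≡ꟳ c
    ... | true  = refl
    ... | false = refl

  -- The edges of one row all meet in v, so a matching contains at most one of them.
  N-row : ∀ k (G : Graph n) v us X →
    N (suc k) (map (v ,_) (filterᵇ (G v) us) ++ X) ≡
    N (suc k) X + ∑ (λ u → ⟦ G v u ⟧ * N k (filterᵇ (disjointᵉ (v , u)) X)) us
  N-row k G v []       X = sym (+-identityʳ _)
  N-row k G v (u ∷ us) X with G v u
  ... | false = N-row k G v us X
  ... | true  = begin
    N (suc k) ((v , u) ∷ (row us ++ X))
      ≡⟨ N-suc k (v , u) (row us ++ X) ⟩
    N (suc k) (row us ++ X) + N k (filterᵇ (disjointᵉ (v , u)) (row us ++ X))
      ≡⟨ cong₂ _+_ (N-row k G v us X) (cong (N k) (trans (filter-++ _ (row us) X) (cong (_++ filterᵇ (disjointᵉ (v , u)) X) (incident (filterᵇ (G v) us))))) ⟩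
    N (suc k) X + ∑ g us + N k (filterᵇ (disjointᵉ (v , u)) X)
      ≡⟨ l (N (suc k) X) (∑ g us) _ ⟩
    N (suc k) X + (1 * N k (filterᵇ (disjointᵉ (v , u)) X) + ∑ g us) ∎
    where
    open ≡-Reasoning
    row : List (Fin n) → List (Edge n)
    row us = map (v ,_) (filterᵇ (G v) us)
    g : Fin n → ℕ
    g u = ⟦ G v u ⟧ * N k (filterᵇ (disjointᵉ (v , u)) X)
    incident : ∀ ts → filterᵇ (disjointᵉ (v , u)) (map (v ,_) ts) ≡ []
    incident []       = refl
    incident (t ∷ ts) rewrite ≡ᵇ-refl (toℕ v) = incident ts
    l : ∀ x y z → x + y + z ≡ x + (1 * z + y)
    l = solve-∀

  N≡M : ∀ (G : Graph n) k {vs} → Unique vs → N k (edgesOn G vs) ≡ M G k vs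
  N≡M G zero    {vs} un = N-zero (edgesOn G vs)
  N≡M G (suc k) []      = refl
  N≡M G (suc k) (_∷_ {v} {vs} v∉ un) = trans (N-row k G v vs (edgesOn G vs))
    (cong₂ _+_ (N≡M G (suc k) un) (trans
      (∑-cong v∉ (λ {u} _ → cong (λ X → ⟦ G v u ⟧ * N k X) (edgesOn-∖ G u v∉)))
      (trans (∑-cong v∉ (λ {u} _ → cong (⟦ G v u ⟧ *_) (N≡M G k (AllPairsₚ.filter⁺ _ un)))) (sym (S≡∑ _ (M G k) un)))))

  pairIf : Fin n → Fin n → List (Edge n)
  pairIf i j = if toℕ i <ᵇ toℕ j then (i , j) ∷ [] else []

  pairs : List (Fin n) → List (Edge n)
  pairs []       = []
  pairs (v ∷ vs) = map (v ,_) vs ++ pairs vs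

  concatMap-pairIf : ∀ {vs} → AllPairs Fin._<_ vs → concatMap (λ i → concatMap (pairIf i) vs) vs ≡ pairs vs
  concatMap-pairIf []                 = refl
  concatMap-pairIf (_∷_ {v} {vs} v< sorted) = cong₂ _++_ row
    (trans (concatMap-cong-local (All.map skip v<)) (concatMap-pairIf sorted))
    where
    skip : ∀ {i} → v Fin.< i → concatMap (pairIf i) (v ∷ vs) ≡ concatMap (pairIf i) vs
    skip v<i rewrite ≥⇒<ᵇ≡ (<⇒≤ v<i) = refl
    after : ∀ {us} → All (v Fin.<_) us → concatMap (pairIf v) us ≡ map (v ,_) us
    after []                    = refl
    after (_∷_ {u} v<u h) rewrite <⇒<ᵇ≡ v<u = cong ((v , u) ∷_) (after h)
    row : concatMap (pairIf v) (v ∷ vs) ≡ map (v ,_) vs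
    row rewrite ≥⇒<ᵇ≡ (≤-refl {toℕ v}) = after v<

  filterᵇ-pairs : ∀ (G : Graph n) vs → filterᵇ (λ p → G (proj₁ p) (proj₂ p)) (pairs vs) ≡ edgesOn G vs
  filterᵇ-pairs G []       = refl
  filterᵇ-pairs G (v ∷ vs) = trans (filter-++ _ (map (v ,_) vs) (pairs vs)) (cong₂ _++_ (row vs) (filterᵇ-pairs G vs))
    where
    row : ∀ us → filterᵇ (λ p → G (proj₁ p) (proj₂ p)) (map (v ,_) us) ≡ map (v ,_) (filterᵇ (G v) us)
    row []       = refl
    row (u ∷ us) with G v u
    ... | true  = cong ((v , u) ∷_) (row us)
    ... | false = row us

-- Unification names the where-bound function of lexPairs, which is not in scope here.
lexPairs-local : ∀ n → Σ[ g ∈ (Fin n → Fin n → List (Edge n)) ]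
  lexPairs n ≡ concatMap (λ i → concatMap (λ j → g i j) (allFin n)) (allFin n)
lexPairs-local n = _ , refl

lexPairs≡ : ∀ n → lexPairs n ≡ concatMap (λ i → concatMap (pairIf i) (allFin n)) (allFin n)
lexPairs≡ n = concatMap-cong (λ i → concatMap-cong (local i) (allFin n)) (allFin n)
  where
  local : ∀ i j → proj₁ (lexPairs-local n) i j ≡ pairIf i j
  local i j with toℕ i <ᵇ toℕ j
  ... | true  = refl
  ... | false = refl

colexPairs-local : ∀ n → Σ[ g ∈ (Fin n → Fin n → List (Edge n)) ]
  colexPairs n ≡ concatMap (λ j → concatMap (λ i → g i j) (allFin n)) (allFin n)
colexPairs-local n = _ , refl

colexPairs≡ : ∀ n → colexPairs n ≡ concatMap (λ j → concatMap (λ i → pairIf i j) (allFin n)) (allFin n)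
colexPairs≡ n = concatMap-cong (λ j → concatMap-cong (λ i → local i j) (allFin n)) (allFin n)
  where
  local : ∀ i j → proj₁ (colexPairs-local n) i j ≡ pairIf i j
  local i j with toℕ i <ᵇ toℕ j
  ... | true  = refl
  ... | false = refl

allFin-sorted : ∀ n → AllPairs Fin._<_ (allFin n)
allFin-sorted n = AllPairsₚ.tabulate⁺-< id

allFin-unique : ∀ n → Unique (allFin n)
allFin-unique n = AllPairs.map (λ i<j → <⇒≢ i<j ∘ cong toℕ) (allFin-sorted n)

edges≡edgesOn : ∀ {n} (G : Graph n) → edges G ≡ edgesOn G (allFin n)
edges≡edgesOn {n} G = trans (cong (filterᵇ _) (trans (lexPairs≡ n) (concatMap-pairIf (allFin-sorted n)))) (filterᵇ-pairs G (allFin n))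

mₖ≡M : ∀ {n} (G : Graph n) k → mₖ k G ≡ M G k (allFin n)
mₖ≡M {n} G k = trans (mₖ≡N k G) (trans (cong (N k) (edges≡edgesOn G)) (N≡M G k (allFin-unique n)))

numEdges≡M : ∀ {n} (G : Graph n) → numEdges G ≡ M G 1 (allFin n)
numEdges≡M {n} G = trans (sym (N-one (edges G))) (trans (cong (N 1) (edges≡edgesOn G)) (N≡M G 1 (allFin-unique n)))

-- Positions of edges in the lex and colex orders

toℕ² : ∀ {n} → Edge n → ℕ × ℕ
toℕ² (i , j) = toℕ i , toℕ j

pairIfℕ : ℕ → ℕ → List (ℕ × ℕ)
pairIfℕ i j = if i <ᵇ j then (i , j) ∷ [] else []

memberᵇ : ℕ → ℕ → List (ℕ × ℕ) → Bool
memberᵇ i j = any (λ p → (proj₁ p ≡ᵇ i) ∧ (proj₂ p ≡ᵇ j))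

elemᵉ≡memberᵇ : ∀ {n} (i j : Fin n) ps → elemᵉ (i , j) ps ≡ memberᵇ (toℕ i) (toℕ j) (map toℕ² ps)
elemᵉ≡memberᵇ i j []       = refl
elemᵉ≡memberᵇ i j (p ∷ ps) = cong (_ ∨_) (elemᵉ≡memberᵇ i j ps)

map-toℕ-allFin : ∀ n → map toℕ (allFin n) ≡ upTo n
map-toℕ-allFin n = trans (map-tabulate id toℕ) (tabulate-toℕ n id)
  where
  tabulate-toℕ : ∀ n (f : ℕ → ℕ) → tabulate {n = n} (f ∘ toℕ) ≡ applyUpTo f n
  tabulate-toℕ zero    f = refl
  tabulate-toℕ (suc n) f = cong (f 0 ∷_) (tabulate-toℕ n (f ∘ suc))

map-pairIf : ∀ {n} (i j : Fin n) → map toℕ² (pairIf i j) ≡ pairIfℕ (toℕ i) (toℕ j)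
map-pairIf i j with toℕ i <ᵇ toℕ j
... | true  = refl
... | false = refl

concatMap-allFin : ∀ {A : Set} n (f : ℕ → List A) → concatMap (f ∘ toℕ) (allFin n) ≡ concatMap f (upTo n)
concatMap-allFin n f = trans (sym (concatMap-map f toℕ (allFin n))) (cong (concatMap f) (map-toℕ-allFin n))

map-toℕ²-concatMap : ∀ n (g : Fin n → Fin n → List (Edge n)) (h : ℕ → ℕ → List (ℕ × ℕ)) →
  (∀ i j → map toℕ² (g i j) ≡ h (toℕ i) (toℕ j)) →
  map toℕ² (concatMap (λ i → concatMap (g i) (allFin n)) (allFin n)) ≡
  concatMap (λ i → concatMap (h i) (upTo n)) (upTo n)
map-toℕ²-concatMap n g h gh = trans (map-concatMap toℕ² _ (allFin n)) (trans
  (concatMap-cong (λ i → trans (map-concatMap toℕ² (g i) (allFin n))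
    (trans (concatMap-cong (gh i) (allFin n)) (concatMap-allFin n (h (toℕ i))))) (allFin n))
  (concatMap-allFin n (λ i → concatMap (h i) (upTo n))))

suc² : ℕ × ℕ → ℕ × ℕ
suc² (i , j) = suc i , suc j

-- Over ℕ instead of `Fin n`, so that both orders follow by recursion on n: lex peels off the
-- smallest vertex, colex the largest.
lexℕ colexℕ : ℕ → List (ℕ × ℕ)
lexℕ zero    = []
lexℕ (suc n) = map (λ j → 0 , suc j) (upTo n) ++ map suc² (lexℕ n)
colexℕ zero    = []
colexℕ (suc n) = colexℕ n ++ map (_, n) (upTo n)

lexPairs-lexℕ : ∀ n → map toℕ² (lexPairs n) ≡ lexℕ n
lexPairs-lexℕ n = trans (cong (map toℕ²) (lexPairs≡ n)) (trans (map-toℕ²-concatMap n pairIf pairIfℕ map-pairIf) (go n))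
  where
  go : ∀ n → concatMap (λ i → concatMap (pairIfℕ i) (upTo n)) (upTo n) ≡ lexℕ n
  go zero    = refl
  go (suc n) rewrite sym (map-upTo suc n) = cong₂ _++_ (first (upTo n)) (begin
    concatMap (λ i → concatMap (pairIfℕ i) (0 ∷ map suc (upTo n))) (map suc (upTo n))
      ≡⟨ concatMap-map _ suc (upTo n) ⟩
    concatMap (λ i → concatMap (pairIfℕ (suc i)) (map suc (upTo n))) (upTo n)
      ≡⟨ concatMap-cong (λ i → trans (concatMap-map _ suc (upTo n))
           (trans (concatMap-cong (shift i) (upTo n)) (sym (map-concatMap suc² (pairIfℕ i) (upTo n))))) (upTo n) ⟩
    concatMap (λ i → map suc² (concatMap (pairIfℕ i) (upTo n))) (upTo n)
      ≡⟨ sym (map-concatMap suc² _ (upTo n)) ⟩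
    map suc² (concatMap (λ i → concatMap (pairIfℕ i) (upTo n)) (upTo n))
      ≡⟨ cong (map suc²) (go n) ⟩
    map suc² (lexℕ n) ∎)
    where
    open ≡-Reasoning
    first : ∀ us → concatMap (pairIfℕ 0) (map suc us) ≡ map (λ j → 0 , suc j) us
    first []       = refl
    first (u ∷ us) = cong (_ ∷_) (first us)
    shift : ∀ i j → pairIfℕ (suc i) (suc j) ≡ map suc² (pairIfℕ i j)
    shift i j with i <ᵇ j
    ... | true  = refl
    ... | false = refl

colexPairs-colexℕ : ∀ n → map toℕ² (colexPairs n) ≡ colexℕ n
colexPairs-colexℕ n = trans (cong (map toℕ²) (colexPairs≡ n)) (trans
  (map-toℕ²-concatMap n (λ j i → pairIf i j) (λ j i → pairIfℕ i j) (λ j i → map-pairIf i j))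
  (trans (concatMap-cong-local (Allₚ.applyUpTo⁺₁ id n (λ {j} j<n → row (_, j) j n (<⇒≤ j<n)))) (go n)))
  where
  row : ∀ {A : Set} (g : ℕ → A) j n → j ≤ n →
    concatMap (λ i → if i <ᵇ j then g i ∷ [] else []) (upTo n) ≡ map g (upTo j)
  row g zero n z≤n = none (upTo n)
    where
    none : ∀ us → concatMap (λ i → if i <ᵇ 0 then g i ∷ [] else []) us ≡ []
    none []       = refl
    none (u ∷ us) = none us
  row g (suc j) (suc n) (s≤s j≤n) rewrite sym (map-upTo suc n) | sym (map-upTo suc j) =
    cong (g 0 ∷_) (trans (concatMap-map _ suc (upTo n)) (trans (row (g ∘ suc) j n j≤n) (map-∘ (upTo j))))
  go : ∀ n → concatMap (λ j → map (_, j) (upTo j)) (upTo n) ≡ colexℕ n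
  go zero    = refl
  go (suc n) = trans (cong (concatMap _) (sym (upTo-∷ʳ n))) (trans (concatMap-++ _ (upTo n) (n ∷ []))
    (cong₂ _++_ (go n) (++-identityʳ _)))

take-++ : ∀ {A : Set} e (xs ys : List A) → take e (xs ++ ys) ≡ take e xs ++ take (e ∸ length xs) ys
take-++ zero    []       ys = refl
take-++ zero    (x ∷ xs) ys = refl
take-++ (suc e) []       ys = refl
take-++ (suc e) (x ∷ xs) ys = cong (x ∷_) (take-++ e xs ys)

memberᵇ-++ : ∀ i j xs ys → memberᵇ i j (xs ++ ys) ≡ memberᵇ i j xs ∨ memberᵇ i j ys
memberᵇ-++ i j []       ys = refl
memberᵇ-++ i j (x ∷ xs) ys = trans (cong (b ∨_) (memberᵇ-++ i j xs ys)) (sym (∨-assoc b _ _))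
  where
  b : Bool
  b = (proj₁ x ≡ᵇ i) ∧ (proj₂ x ≡ᵇ j)

memberᵇ-take-++ : ∀ i j e xs ys →
  memberᵇ i j (take e (xs ++ ys)) ≡ memberᵇ i j (take e xs) ∨ memberᵇ i j (take (e ∸ length xs) ys)
memberᵇ-take-++ i j e xs ys = trans (cong (memberᵇ i j) (take-++ e xs ys)) (memberᵇ-++ i j (take e xs) _)

memberᵇ-absent : ∀ i j {ps} → All (λ p → ((proj₁ p ≡ᵇ i) ∧ (proj₂ p ≡ᵇ j)) ≡ false) ps → memberᵇ i j ps ≡ false
memberᵇ-absent i j []       = refl
memberᵇ-absent i j (h ∷ hs) rewrite h = memberᵇ-absent i j hs

any-take-upTo : ∀ j d n → j < n → any (_≡ᵇ j) (take d (upTo n)) ≡ (j <ᵇ d)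
any-take-upTo j       zero    (suc n) _         = refl
any-take-upTo zero    (suc d) (suc n) _         = refl
any-take-upTo (suc j) (suc d) (suc n) (s≤s j<n) = trans
  (cong (any (_≡ᵇ suc j)) (trans (cong (take d) (sym (map-upTo suc n))) (take-map d (upTo n))))
  (trans (any-map (take d (upTo n))) (any-take-upTo j d n j<n))
  where
  any-map : ∀ us → any (_≡ᵇ suc j) (map suc us) ≡ any (_≡ᵇ j) us
  any-map []       = refl
  any-map (u ∷ us) = cong ((u ≡ᵇ j) ∨_) (any-map us)

-- The first n edges in lex order are those at vertex 0; the other `e ∸ n` form the lex graph on the
-- remaining vertices.
lexAdj : ℕ → ℕ → ℕ → ℕ → Bool
lexAdj (suc n) e zero    (suc j) = j <ᵇ e
lexAdj (suc n) e (suc i) (suc j) = lexAdj n (e ∸ n) i j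
lexAdj _       _ _       _       = false

memberᵇ-lexℕ : ∀ n e i j → i < j → j < n → memberᵇ i j (take e (lexℕ n)) ≡ lexAdj n e i j
memberᵇ-lexℕ (suc n) e zero (suc j) _ (s≤s j<n) = begin
  memberᵇ 0 (suc j) (take e (lexℕ (suc n)))
    ≡⟨ memberᵇ-take-++ 0 (suc j) e (map (λ j → 0 , suc j) (upTo n)) (map suc² (lexℕ n)) ⟩
  memberᵇ 0 (suc j) (take e (map (λ j → 0 , suc j) (upTo n)))
    ∨ memberᵇ 0 (suc j) (take (e ∸ length (map (λ j → 0 , suc j) (upTo n))) (map suc² (lexℕ n)))
    ≡⟨ cong₂ _∨_ (trans (cong (memberᵇ 0 (suc j)) (take-map e (upTo n))) (trans (row (take e (upTo n))) (any-take-upTo j e n j<n)))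
         (memberᵇ-absent 0 (suc j) (Allₚ.take⁺ (e ∸ length (map (λ j → 0 , suc j) (upTo n))) (Allₚ.map⁺ (All.universal (λ _ → refl) (lexℕ n))))) ⟩
  (j <ᵇ e) ∨ false
    ≡⟨ ∨-identityʳ _ ⟩
  (j <ᵇ e) ∎
  where
  open ≡-Reasoning
  row : ∀ us → memberᵇ 0 (suc j) (map (λ j → 0 , suc j) us) ≡ any (_≡ᵇ j) us
  row []       = refl
  row (u ∷ us) = cong ((u ≡ᵇ j) ∨_) (row us)
memberᵇ-lexℕ (suc n) e (suc i) (suc j) (s≤s i<j) (s≤s j<n) = begin
  memberᵇ (suc i) (suc j) (take e (lexℕ (suc n)))
    ≡⟨ memberᵇ-take-++ (suc i) (suc j) e (map (λ j → 0 , suc j) (upTo n)) (map suc² (lexℕ n)) ⟩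
  memberᵇ (suc i) (suc j) (take e (map (λ j → 0 , suc j) (upTo n)))
    ∨ memberᵇ (suc i) (suc j) (take (e ∸ length (map (λ j → 0 , suc j) (upTo n))) (map suc² (lexℕ n)))
    ≡⟨ cong₂ _∨_ (memberᵇ-absent (suc i) (suc j) (Allₚ.take⁺ e (Allₚ.map⁺ (All.universal (λ _ → refl) (upTo n)))))
         (cong (λ d → memberᵇ (suc i) (suc j) (take (e ∸ d) (map suc² (lexℕ n)))) (trans (length-map _ (upTo n)) (length-upTo n))) ⟩
  memberᵇ (suc i) (suc j) (take (e ∸ n) (map suc² (lexℕ n)))
    ≡⟨ cong (memberᵇ (suc i) (suc j)) (take-map (e ∸ n) (lexℕ n)) ⟩
  memberᵇ (suc i) (suc j) (map suc² (take (e ∸ n) (lexℕ n)))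
    ≡⟨ shift (take (e ∸ n) (lexℕ n)) ⟩
  memberᵇ i j (take (e ∸ n) (lexℕ n))
    ≡⟨ memberᵇ-lexℕ n (e ∸ n) i j i<j j<n ⟩
  lexAdj n (e ∸ n) i j ∎
  where
  open ≡-Reasoning
  shift : ∀ ps → memberᵇ (suc i) (suc j) (map suc² ps) ≡ memberᵇ i j ps
  shift []       = refl
  shift (p ∷ ps) = cong (_ ∨_) (shift ps)

length-colexℕ : ∀ n → length (colexℕ n) ≡ tri n
length-colexℕ zero    = refl
length-colexℕ (suc n) = trans (length-++ (colexℕ n)) (trans
  (cong₂ _+_ (length-colexℕ n) (trans (length-map _ (upTo n)) (length-upTo n))) (+-comm (tri n) n))

colexℕ-bound : ∀ n → All (λ p → proj₂ p < n) (colexℕ n)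
colexℕ-bound zero    = []
colexℕ-bound (suc n) = Allₚ.++⁺ (All.map m≤n⇒m≤1+n (colexℕ-bound n)) (Allₚ.map⁺ (All.universal (λ _ → ≤-refl) (upTo n)))

-- `tri j + i` is the position of {i, j} in colex order: the edges below j come first, and n does
-- not enter.
memberᵇ-colexℕ : ∀ n e i j → i < j → j < n → memberᵇ i j (take e (colexℕ n)) ≡ (tri j + i <ᵇ e)
memberᵇ-colexℕ (suc n) e i j i<j (s≤s j≤n) = trans (memberᵇ-take-++ i j e (colexℕ n) (map (_, n) (upTo n)))
  (go (m≤n⇒m<n∨m≡n j≤n))
  where
  d : ℕ
  d = e ∸ length (colexℕ n)
  ∧-false : ∀ b {c} → c ≡ false → b ∧ c ≡ false
  ∧-false b refl = ∧-zeroʳ b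
  row : ∀ us → memberᵇ i n (map (_, n) us) ≡ any (_≡ᵇ i) us
  row []       = refl
  row (u ∷ us) rewrite ≡ᵇ-refl n = cong₂ _∨_ (∧-identityʳ _) (row us)
  go : j < n ⊎ j ≡ n → memberᵇ i j (take e (colexℕ n)) ∨ memberᵇ i j (take d (map (_, n) (upTo n))) ≡ (tri j + i <ᵇ e)
  go (inj₁ j<n) = trans (cong₂ _∨_ (memberᵇ-colexℕ n e i j i<j j<n)
    (memberᵇ-absent i j (Allₚ.take⁺ d (Allₚ.map⁺ (All.universal (λ u → ∧-false (u ≡ᵇ i) (≢⇒≡ᵇ (<⇒≢ j<n ∘ sym))) (upTo n))))))
    (∨-identityʳ _)
  go (inj₂ refl) = trans (cong₂ _∨_
    (memberᵇ-absent i j (Allₚ.take⁺ e (All.map (λ {p} lt → ∧-false (proj₁ p ≡ᵇ i) (≢⇒≡ᵇ (<⇒≢ lt))) (colexℕ-bound n))))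
    (trans (cong (memberᵇ i n) (take-map d (upTo n))) (trans (row (take d (upTo n))) (any-take-upTo i d n i<j))))
    (trans (cong (λ t → i <ᵇ e ∸ t) (length-colexℕ n)) (sym (<ᵇ-∸ (tri n) e i)))

lexGraph≡lexAdj : ∀ {n} e {i j : Fin n} → i Fin.< j → lexGraph n e i j ≡ lexAdj n e (toℕ i) (toℕ j)
lexGraph≡lexAdj {n} e {i} {j} i<j = trans (elemᵉ≡memberᵇ i j (take e (lexPairs n)))
  (trans (cong (memberᵇ (toℕ i) (toℕ j)) (trans (sym (take-map e (lexPairs n))) (cong (take e) (lexPairs-lexℕ n))))
    (memberᵇ-lexℕ n e (toℕ i) (toℕ j) i<j (toℕ<n j)))

colexGraph≡ : ∀ {n} e {i j : Fin n} → i Fin.< j → colexGraph n e i j ≡ (tri (toℕ j) + toℕ i <ᵇ e)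
colexGraph≡ {n} e {i} {j} i<j = trans (elemᵉ≡memberᵇ i j (take e (colexPairs n)))
  (trans (cong (memberᵇ (toℕ i) (toℕ j)) (trans (sym (take-map e (colexPairs n))) (cong (take e) (colexPairs-colexℕ n))))
    (memberᵇ-colexℕ n e (toℕ i) (toℕ j) i<j (toℕ<n j)))

-- Matching numbers of the lex and colex graphs, and the bound for every k

module _ {V : Set} where

  -- Carries pairwise information along the list. It serves relations that agree only for i < j,
  -- compared along a sorted list.
  S-congᴾ : ∀ {P : V → Set} {Q : V → V → Set} {a b f g vs} → All P vs → AllPairs Q vs →
    (∀ {u} → P u → a u ≡ b u) → (∀ {r} → All P r → AllPairs Q r → f r ≡ g r) → S a f vs ≡ S b g vs
  S-congᴾ []       []       ab fg = refl
  S-congᴾ (p ∷ ps) (q ∷ qs) ab fg = cong₂ _+_ (cong₂ _*_ (ab p) (fg ps qs))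
    (S-congᴾ (All.zip (ps , q)) qs (ab ∘ proj₁)
      (λ pqs qs′ → fg (p ∷ proj₁ (All.unzip pqs)) (proj₂ (All.unzip pqs) ∷ qs′)))

  M-congᴾ : ∀ {R R′ : V → V → Bool} k {vs} → AllPairs (λ u v → R u v ≡ R′ u v) vs → M R k vs ≡ M R′ k vs
  M-congᴾ zero    qs       = refl
  M-congᴾ (suc k) []       = refl
  M-congᴾ (suc k) (q ∷ qs) = cong₂ _+_ (M-congᴾ (suc k) qs) (S-congᴾ q qs (cong ⟦_⟧) (λ _ → M-congᴾ k))

  S-map : ∀ {U : Set} (g : U → V) a f us → S a f (map g us) ≡ S (a ∘ g) (f ∘ map g) us
  S-map g a f []       = refl
  S-map g a f (u ∷ us) = cong (a (g u) * f (map g us) +_) (S-map g a (f ∘ (g u ∷_)) us)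

  M-map : ∀ {U : Set} (g : U → V) R k us → M R k (map g us) ≡ M (λ u v → R (g u) (g v)) k us
  M-map g R zero    us       = refl
  M-map g R (suc k) []       = refl
  M-map g R (suc k) (u ∷ us) = cong₂ _+_ (M-map g R (suc k) us)
    (trans (S-map g _ (M R k) us) (S-congʳ (M-map g R k) us))

  S-const : ∀ a (g : ℕ → ℕ) (vs : List V) → S a (g ∘ length) vs ≡ S a (λ _ → 1) vs * g (pred (length vs))
  S-const a g []       = refl
  S-const a g (u ∷ us) = trans (cong (a u * g (length us) +_) (trans (S-const a (g ∘ suc) us) (lem us)))
    (l (a u) (g (length us)) (S a (λ _ → 1) us))
    where
    lem : ∀ us → S a (λ _ → 1) us * g (suc (pred (length us))) ≡ S a (λ _ → 1) us * g (length us)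
    lem []       = refl
    lem (_ ∷ us) = refl
    l : ∀ x y z → x * y + z * y ≡ (x * 1 + z) * y
    l = solve-∀

  M-empty : ∀ R → (∀ u v → R u v ≡ false) → ∀ k (vs : List V) → M R k vs ≡ star 0 k
  M-empty R h zero    vs       = refl
  M-empty R h (suc zero)    [] = refl
  M-empty R h (suc (suc k)) [] = refl
  M-empty R h (suc k) (v ∷ vs) = trans (M-isolated R v (All.universal (h v) vs) (suc k)) (M-empty R h (suc k) vs)

  M-complete : ∀ R k {vs : List V} → AllPairs (λ u v → R u v ≡ true) vs → M R k vs ≡ W (length vs) 0 k
  M-complete R zero    qs = refl
  M-complete R (suc k) []       = refl
  M-complete R (suc k) (_∷_ {v} {vs} q qs) = begin
    M R (suc k) (v ∷ vs)
      ≡⟨ M-dominator R v q (suc k) ⟩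
    M R (suc k) vs + (length vs ∸ 2 * k) * M R k vs
      ≡⟨ cong₂ (λ x y → x + (length vs ∸ 2 * k) * y) (M-complete R (suc k) qs) (M-complete R k qs) ⟩
    W (length vs) 0 (suc k) + (length vs ∸ 2 * k) * W (length vs) 0 k
      ≡⟨ cong (λ m → W (length vs) 0 (suc k) + (m ∸ 2 * k) * W (length vs) 0 k) (sym (+-identityʳ (length vs))) ⟩
    D (length vs + 0) (W (length vs) 0) (suc k)
      ≡⟨ D-W (length vs) 0 (suc k) ⟩
    W (suc (length vs)) 0 (suc k) ∎
    where open ≡-Reasoning

S-initial : ∀ n d → d ≤ n → S (λ u → ⟦ u <ᵇ d ⟧) (λ _ → 1) (upTo n) ≡ d
S-initial n       zero    z≤n       = S-zero {P = λ _ → ℕ} (All.universal id (upTo n)) (λ _ → refl)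
S-initial (suc n) (suc d) (s≤s d≤n) = cong suc (trans (cong (S (λ u → ⟦ u <ᵇ suc d ⟧) (λ _ → 1)) (sym (map-upTo suc n)))
  (trans (S-map suc _ _ (upTo n)) (S-initial n d d≤n)))

lexAdj-empty : ∀ n i j → lexAdj n 0 i j ≡ false
lexAdj-empty zero    zero    j       = refl
lexAdj-empty zero    (suc i) j       = refl
lexAdj-empty (suc n) zero    zero    = refl
lexAdj-empty (suc n) zero    (suc j) = refl
lexAdj-empty (suc n) (suc i) zero    = refl
lexAdj-empty (suc n) (suc i) (suc j) = trans (cong (λ e → lexAdj n e i j) (0∸n≡0 n)) (lexAdj-empty n i j)

M-lexAdj : ∀ n e k → M (lexAdj n e) k (upTo n) ≡ lex n e k
M-lexAdj n       e zero    = sym (lex-zero n e)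
M-lexAdj zero    e (suc zero)    = refl
M-lexAdj zero    e (suc (suc k)) = refl
M-lexAdj (suc n) e (suc k) rewrite sym (map-upTo suc n) with e ≤? n
... | yes e≤n = trans (cong₂ _+_ (rest (suc k) (upTo n)) (trans (S-map suc _ _ (upTo n)) (S-congʳ (rest k) (upTo n)))) (count k)
  where
  rest : ∀ k us → M (lexAdj (suc n) e) k (map suc us) ≡ star 0 k
  rest k us = trans (M-map suc (lexAdj (suc n) e) k us)
    (M-empty _ (λ i j → trans (cong (λ d → lexAdj n d i j) (m≤n⇒m∸n≡0 e≤n)) (lexAdj-empty n i j)) k us)
  count : ∀ k → star 0 (suc k) + S (λ u → ⟦ u <ᵇ e ⟧) (λ _ → star 0 k) (upTo n) ≡ star e (suc k)
  count zero          = S-initial n e e≤n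
  count (suc zero)    = S-*ʳ _ 0 (λ _ → 0) (upTo n)
  count (suc (suc k)) = S-*ʳ _ 0 (λ _ → 0) (upTo n)
... | no e≰n = trans (M-dominator (lexAdj (suc n) e) 0 dom (suc k))
  (trans (cong (λ m → D m (λ k → M (lexAdj (suc n) e) k (map suc (upTo n))) (suc k)) (trans (length-map suc (upTo n)) (length-upTo n)))
    (D-cong n (λ k → trans (M-map suc (lexAdj (suc n) e) k (upTo n)) (M-lexAdj n (e ∸ n) k)) (suc k)))
  where
  dom : All (λ u → lexAdj (suc n) e 0 u ≡ true) (map suc (upTo n))
  dom = Allₚ.map⁺ (Allₚ.applyUpTo⁺₁ id n (λ i<n → <⇒<ᵇ≡ (<-trans i<n (≰⇒> e≰n))))

-- Made symmetric by maximum and minimum so that the vertices can be listed in descending order,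
-- with the vertex that colex peels off at the head.
colexAdj : ℕ → ℕ → ℕ → Bool
colexAdj e i j = tri (i ⊔ j) + i ⊓ j <ᵇ e

colexAdj-sym : ∀ e → Symmetricᵇ (colexAdj e)
colexAdj-sym e i j rewrite ⊔-comm i j | ⊓-comm i j = refl

colexAdj-> : ∀ e {i j} → j < i → colexAdj e i j ≡ (tri i + j <ᵇ e)
colexAdj-> e j<i rewrite m≥n⇒m⊔n≡m (<⇒≤ j<i) | m≥n⇒m⊓n≡n (<⇒≤ j<i) = refl

M-colexAdj : ∀ n e → e ≤ tri n → ∀ k → M (colexAdj e) k (downFrom n) ≡ col n e k
M-colexAdj zero    e e≤ zero          = refl
M-colexAdj zero    e e≤ (suc zero)    = refl
M-colexAdj zero    e e≤ (suc (suc k)) = refl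
M-colexAdj (suc n) e e≤ k with e ≤? tri n
... | yes e≤′ = trans (M-isolated (colexAdj e) n (Allₚ.applyDownFrom⁺₁ id n (λ {i} i<n →
    trans (colexAdj-> e i<n) (≥⇒<ᵇ≡ (≤-trans e≤′ (m≤m+n (tri n) i))))) k) (M-colexAdj n e e≤′ k)
... | no e≰ = go k
  where
  e>tri : tri n < e
  e>tri = ≰⇒> e≰
  complete : AllPairs (λ u v → colexAdj e u v ≡ true) (downFrom n)
  complete = AllPairsₚ.applyDownFrom⁺₁ id n (λ {i} {j} j<i i<n → trans (colexAdj-> e j<i) (<⇒<ᵇ≡
    (≤-<-trans (≤-trans (+-monoʳ-≤ (tri i) (<⇒≤ j<i)) (≤-trans (≤-reflexive (+-comm (tri i) i)) (tri-mono i<n))) e>tri)))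
  below : All (_< n) (downFrom n)
  below = Allₚ.applyDownFrom⁺₁ id n id
  count : S (λ u → ⟦ colexAdj e n u ⟧) (λ _ → 1) (downFrom n) ≡ e ∸ tri n
  count = trans (S-cong below (λ {u} u<n → cong ⟦_⟧ (trans (colexAdj-> e u<n) (<ᵇ-∸ (tri n) e u))) (λ _ → refl))
    (trans (S-↭ _ (λ _ → refl) (↭-trans (↭-reflexive (sym (reverse-upTo n))) (↭-reverse (upTo n))))
      (S-initial n (e ∸ tri n) (≤-trans (∸-monoˡ-≤ (tri n) e≤) (≤-reflexive (m+n∸n≡m n (tri n))))))
  go : ∀ k → M (colexAdj e) k (n ∷ downFrom n) ≡ quasiClique n (e ∸ tri n) k
  go zero    = refl
  go (suc k) = cong₂ _+_ (trans (M-complete (colexAdj e) (suc k) complete) (cong (λ m → W m 0 (suc k)) (length-downFrom n)))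
    (trans (S-congᴾ below complete (λ _ → refl) (λ _ → M-complete (colexAdj e) k))
      (trans (S-const _ (λ m → W m 0 k) (downFrom n))
        (cong₂ (λ c m → c * W (pred m) 0 k) count (length-downFrom n))))

mₖ-lexGraph : ∀ n e k → mₖ k (lexGraph n e) ≡ lex n e k
mₖ-lexGraph n e k = begin
  mₖ k (lexGraph n e)
    ≡⟨ mₖ≡M (lexGraph n e) k ⟩
  M (lexGraph n e) k (allFin n)
    ≡⟨ M-congᴾ k (AllPairs.map (lexGraph≡lexAdj e) (allFin-sorted n)) ⟩
  M (λ i j → lexAdj n e (toℕ i) (toℕ j)) k (allFin n)
    ≡⟨ sym (M-map toℕ (lexAdj n e) k (allFin n)) ⟩
  M (lexAdj n e) k (map toℕ (allFin n))
    ≡⟨ cong (M (lexAdj n e) k) (map-toℕ-allFin n) ⟩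
  M (lexAdj n e) k (upTo n)
    ≡⟨ M-lexAdj n e k ⟩
  lex n e k ∎
  where open ≡-Reasoning

mₖ-colexGraph : ∀ n e → e ≤ tri n → ∀ k → mₖ k (colexGraph n e) ≡ col n e k
mₖ-colexGraph n e e≤ k = begin
  mₖ k (colexGraph n e)
    ≡⟨ mₖ≡M (colexGraph n e) k ⟩
  M (colexGraph n e) k (allFin n)
    ≡⟨ M-congᴾ k (AllPairs.map (λ {i} {j} i<j → trans (colexGraph≡ e i<j)
         (sym (trans (colexAdj-sym e (toℕ i) (toℕ j)) (colexAdj-> e i<j)))) (allFin-sorted n)) ⟩
  M (λ i j → colexAdj e (toℕ i) (toℕ j)) k (allFin n)
    ≡⟨ sym (M-map toℕ (colexAdj e) k (allFin n)) ⟩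
  M (colexAdj e) k (map toℕ (allFin n))
    ≡⟨ cong (M (colexAdj e) k) (map-toℕ-allFin n) ⟩
  M (colexAdj e) k (upTo n)
    ≡⟨ M-↭ (colexAdj-sym e) k (↭-trans (↭-sym (↭-reverse (upTo n))) (↭-reflexive (reverse-upTo n))) ⟩
  M (colexAdj e) k (downFrom n)
    ≡⟨ M-colexAdj n e e≤ k ⟩
  col n e k ∎
  where open ≡-Reasoning

-- A `Graph` is read only at i < j, whereas the induction permutes the vertices and needs a
-- symmetric relation.
symmetrise : ∀ {n} → Graph n → Graph n
symmetrise G u v = ((toℕ u <ᵇ toℕ v) ∧ G u v) ∨ ((toℕ v <ᵇ toℕ u) ∧ G v u)

symmetrise-< : ∀ {n} (G : Graph n) {u v} → u Fin.< v → G u v ≡ symmetrise G u v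
symmetrise-< G u<v rewrite <⇒<ᵇ≡ u<v | ≥⇒<ᵇ≡ (<⇒≤ u<v) = sym (∨-identityʳ _)

mₖ-extremal : ∀ {n} (G : Graph n) →
  (∀ k → mₖ k (lexGraph n (numEdges G)) ≤ mₖ k G) ⊎ (∀ k → mₖ k (colexGraph n (numEdges G)) ≤ mₖ k G)
mₖ-extremal {n} G = go (extremal Fin._≟_ n (symmetrise G) sy (allFin n) (allFin-unique n) len)
  where
  len : length (allFin n) ≡ n
  len = length-tabulate id
  p : ℕ → ℕ
  p k = M (symmetrise G) k (allFin n)
  sy : Symmetricᵇ (symmetrise G)
  sy u v = ∨-comm ((toℕ u <ᵇ toℕ v) ∧ G u v) _
  M≡p : ∀ k → M G k (allFin n) ≡ p k
  M≡p k = M-congᴾ k (AllPairs.map (symmetrise-< G) (allFin-sorted n))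
  mₖ≡p : ∀ k → mₖ k G ≡ p k
  mₖ≡p k = trans (mₖ≡M G k) (M≡p k)
  e≡ : numEdges G ≡ p 1
  e≡ = trans (numEdges≡M G) (M≡p 1)
  e≤ : numEdges G ≤ tri n
  e≤ = ≤-trans (≤-reflexive e≡) (subst (λ l → p 1 ≤ tri l) len (M₁≤tri (symmetrise G) (allFin n)))
  go : Extremal p n → _
  go (aboveLex h) = inj₁ λ k → subst (_≤ mₖ k G) (trans (cong (λ e → lex n e k) (sym e≡)) (sym (mₖ-lexGraph n (numEdges G) k)))
    (≤-trans (h k) (≤-reflexive (sym (mₖ≡p k))))
  go (aboveCol h) = inj₂ λ k → subst (_≤ mₖ k G) (trans (cong (λ e → col n e k) (sym e≡)) (sym (mₖ-colexGraph n (numEdges G) e≤ k)))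
    (≤-trans (h k) (≤-reflexive (sym (mₖ≡p k))))

-- From the numbers of k-matchings to their total

∑< : ℕ → (ℕ → ℕ) → ℕ
∑< zero    f = 0
∑< (suc n) f = f n + ∑< n f

∑<-mono : ∀ n {f g} → (∀ k → f k ≤ g k) → ∑< n f ≤ ∑< n g
∑<-mono zero    fg = z≤n
∑<-mono (suc n) fg = +-mono-≤ (fg n) (∑<-mono n fg)

∑<-+ : ∀ n f g → ∑< n (λ k → f k + g k) ≡ ∑< n f + ∑< n g
∑<-+ zero    f g = refl
∑<-+ (suc n) f g rewrite ∑<-+ n f g = l (f n) (g n) (∑< n f) (∑< n g)
  where
  l : ∀ x y z w → x + y + (z + w) ≡ x + z + (y + w)
  l = solve-∀

∑<-indicator-zero : ∀ n l → n ≤ l → ∑< n (λ k → ⟦ l ≡ᵇ k ⟧) ≡ 0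
∑<-indicator-zero zero    l _   = refl
∑<-indicator-zero (suc n) l n<l rewrite ≢⇒≡ᵇ {l} {n} (<⇒≢ n<l ∘ sym) = ∑<-indicator-zero n l (<⇒≤ n<l)

∑<-indicator : ∀ n l → l < n → ∑< n (λ k → ⟦ l ≡ᵇ k ⟧) ≡ 1
∑<-indicator (suc n) l (s≤s l≤n) with m≤n⇒m<n∨m≡n l≤n
... | inj₁ l<n rewrite ≢⇒≡ᵇ (<⇒≢ l<n) = ∑<-indicator n l l<n
... | inj₂ refl rewrite ≡ᵇ-refl l     = cong suc (∑<-indicator-zero l l ≤-refl)

module _ {A : Set} where

  ofLength : ℕ → List (List A) → ℕ
  ofLength k = cnt (λ s → length s ≡ᵇ k)

  ∑<-ofLength≤ : ∀ n xss → ∑< n (λ k → ofLength k xss) ≤ length xss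
  ∑<-ofLength≤ n []         = ≤-reflexive (zeros n)
    where
    zeros : ∀ n → ∑< n (λ _ → 0) ≡ 0
    zeros zero    = refl
    zeros (suc n) = zeros n
  ∑<-ofLength≤ n (xs ∷ xss) = ≤-trans (≤-reflexive (∑<-+ n _ _)) (+-mono-≤ (one (<-≤-connex (length xs) n)) (∑<-ofLength≤ n xss))
    where
    one : length xs < n ⊎ n ≤ length xs → ∑< n (λ k → ⟦ length xs ≡ᵇ k ⟧) ≤ 1
    one (inj₁ lt) = ≤-reflexive (∑<-indicator n _ lt)
    one (inj₂ ge) = ≤-trans (≤-reflexive (∑<-indicator-zero n _ ge)) z≤n

  -- One more than the greatest length, hence a strict cutoff for the sum over k. In `length-mono`
  -- the cutoff is taken from the smaller family; for the larger one a truncated sum is already a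
  -- lower bound.
  maxLength : List (List A) → ℕ
  maxLength []         = 0
  maxLength (xs ∷ xss) = suc (length xs) ⊔ maxLength xss

  length≤∑<-ofLength : ∀ n xss → maxLength xss ≤ n → length xss ≤ ∑< n (λ k → ofLength k xss)
  length≤∑<-ofLength n []         _ = z≤n
  length≤∑<-ofLength n (xs ∷ xss) h = ≤-trans (+-mono-≤
    (≤-reflexive (sym (∑<-indicator n _ (m⊔n≤o⇒m≤o (suc (length xs)) (maxLength xss) h))))
    (length≤∑<-ofLength n xss (m⊔n≤o⇒n≤o (suc (length xs)) (maxLength xss) h)))
    (≤-reflexive (sym (∑<-+ n _ _)))

  length-mono : ∀ {xss yss} → (∀ k → ofLength k xss ≤ ofLength k yss) → length xss ≤ length yss
  length-mono {xss} {yss} h = ≤-trans (length≤∑<-ofLength (maxLength xss) xss ≤-refl)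
    (≤-trans (∑<-mono (maxLength xss) h) (∑<-ofLength≤ (maxLength xss) yss))

m-mono : ∀ {n} (G H : Graph n) → (∀ k → mₖ k G ≤ mₖ k H) → m G ≤ m H
m-mono G H h = length-mono {xss = matchings G} {matchings H} λ k →
  subst (ofLength k (matchings G) ≤_) (length-filterᵇ _ (matchings H))
    (≤-trans (≤-reflexive (sym (length-filterᵇ _ (matchings G)))) (h k))

theorem1p2 : (n e : ℕ) → 1 ≤ n → e ≤ n C 2 →
    (G : Graph n) → numEdges G ≡ e →
    (m (lexGraph n e) ⊓ m (colexGraph n e) ≤ m G)
    × ((k : ℕ) → mₖ k (lexGraph n e) ⊓ mₖ k (colexGraph n e) ≤ mₖ k G)
theorem1p2 n e _ _ G refl with mₖ-extremal G
... | inj₁ h = ≤-trans (m⊓n≤m _ _) (m-mono (lexGraph n e) G h) , λ k → ≤-trans (m⊓n≤m _ _) (h k)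
... | inj₂ h = ≤-trans (m⊓n≤n _ _) (m-mono (colexGraph n e) G h) , λ k → ≤-trans (m⊓n≤n _ _) (h k)
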